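{- Let $P$ be a finite set of points in the plane in general position with $|P|$ even, and let $A\subseteq P$ be the union of the vertex sets of some connected components of the underlying graph of $P$. If $a,b\in A$ and the line through $a$ and $b$ is a halving line of $P$, then the two open half-planes determined by this line contain equally many points of $A$.
   Context: Points are in general position if no three are collinear. For a finite set $P$ of $n$ points in general position with $n$ even, a halving line of $P$ is a line through two points of $P$ that has exactly $(n-2)/2$ points of $P$ strictly on each side. The underlying graph of $P$ has vertex set $P$, and two points are adjacent if and only if the line through them is a halving line of $P$. -}

module Defs where

open import Data.Nat as ℕ using (ℕ; _⊔_; _∸_)
import Data.Nat.Properties as ℕ
open import Data.Nat.DivMod using (_/_)
open import Data.Rational as ℚ using (ℚ; 0ℚ; 1ℚ; ½)
import Data.Rational.Properties as ℚ
open import Data.Rational.Solver using (module +-*-Solver)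
open import Data.Fin using (Fin)
open import Data.Fin.Subset using (Subset; _∈_; ∣_∣)
open import Data.Product using (_×_; _,_; ∃-syntax)
open import Function using (_⇔_)
open import Relation.Binary.Construct.Closure.ReflexiveTransitive using (Star)
open import Relation.Binary.PropositionalEquality
  using (_≡_; _≢_; refl; sym; trans; cong; subst)
open import Relation.Nullary using (¬_)

-- The real numbers, constructed as Cauchy sequences of rationals; two
-- sequences represent the same real number when they are related by _≈_.

IsCauchy : (ℕ → ℚ) → Set
IsCauchy x = ∀ ε → 0ℚ ℚ.< ε → ∃[ N ] (∀ m n → N ℕ.≤ m → N ℕ.≤ n → ℚ.∣ x m ℚ.- x n ∣ ℚ.< ε)

record ℝ : Set where
  constructor mkℝ
  field
    seq    : ℕ → ℚ
    cauchy : IsCauchy seq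

open ℝ public

infix 4 _≈_ _<_

_≈_ : ℝ → ℝ → Set
x ≈ y = ∀ ε → 0ℚ ℚ.< ε → ∃[ N ] (∀ n → N ℕ.≤ n → ℚ.∣ seq x n ℚ.- seq y n ∣ ℚ.< ε)

_<_ : ℝ → ℝ → Set
x < y = ∃[ ε ] (0ℚ ℚ.< ε × ∃[ N ] (∀ n → N ℕ.≤ n → seq x n ℚ.+ ε ℚ.< seq y n))

private

  open ℚ.≤-Reasoning

  sub-close : ∀ {ε} a b c d → ℚ.∣ a ℚ.- c ∣ ℚ.< ½ ℚ.* ε → ℚ.∣ b ℚ.- d ∣ ℚ.< ½ ℚ.* ε →
              ℚ.∣ (a ℚ.- b) ℚ.- (c ℚ.- d) ∣ ℚ.< ε
  sub-close {ε} a b c d p q = begin-strict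
    ℚ.∣ (a ℚ.- b) ℚ.- (c ℚ.- d) ∣        ≡⟨ cong ℚ.∣_∣ (rearrange a b c d) ⟩
    ℚ.∣ (a ℚ.- c) ℚ.- (b ℚ.- d) ∣        ≤⟨ ℚ.∣p-q∣≤∣p∣+∣q∣ (a ℚ.- c) (b ℚ.- d) ⟩
    ℚ.∣ a ℚ.- c ∣ ℚ.+ ℚ.∣ b ℚ.- d ∣      <⟨ ℚ.+-mono-< p q ⟩
    ½ ℚ.* ε ℚ.+ ½ ℚ.* ε                  ≡⟨ sym (ℚ.*-distribʳ-+ ε ½ ½) ⟩
    1ℚ ℚ.* ε                             ≡⟨ ℚ.*-identityˡ ε ⟩
    ε                                    ∎
    where
    rearrange : ∀ a b c d → (a ℚ.- b) ℚ.- (c ℚ.- d) ≡ (a ℚ.- c) ℚ.- (b ℚ.- d)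
    rearrange = solve 4 (λ a b c d → (a :- b) :- (c :- d) := (a :- c) :- (b :- d)) refl
      where open +-*-Solver

  product-bound : ∀ {B δ} p q → 0ℚ ℚ.< B → ℚ.∣ p ∣ ℚ.≤ B → ℚ.∣ q ∣ ℚ.< δ → ℚ.∣ p ℚ.* q ∣ ℚ.< B ℚ.* δ
  product-bound {B} {δ} p q 0<B p≤B q<δ = begin-strict
    ℚ.∣ p ℚ.* q ∣          ≡⟨ ℚ.∣p*q∣≡∣p∣*∣q∣ p q ⟩
    ℚ.∣ p ∣ ℚ.* ℚ.∣ q ∣    ≤⟨ ℚ.*-monoʳ-≤-nonNeg ℚ.∣ q ∣ {{ℚ.nonNegative (ℚ.0≤∣p∣ q)}} p≤B ⟩
    B ℚ.* ℚ.∣ q ∣          <⟨ ℚ.*-monoʳ-<-pos B {{ℚ.positive 0<B}} q<δ ⟩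
    B ℚ.* δ                ∎

  mul-close : ∀ {B C δ} a b c d → 0ℚ ℚ.< B → 0ℚ ℚ.< C → ℚ.∣ a ∣ ℚ.≤ B → ℚ.∣ d ∣ ℚ.≤ C →
              ℚ.∣ a ℚ.- c ∣ ℚ.< δ → ℚ.∣ b ℚ.- d ∣ ℚ.< δ →
              ℚ.∣ a ℚ.* b ℚ.- c ℚ.* d ∣ ℚ.< (B ℚ.+ C) ℚ.* δ
  mul-close {B} {C} {δ} a b c d 0<B 0<C a≤B d≤C p q = begin-strict
    ℚ.∣ a ℚ.* b ℚ.- c ℚ.* d ∣
      ≡⟨ cong ℚ.∣_∣ (split a b c d) ⟩
    ℚ.∣ a ℚ.* (b ℚ.- d) ℚ.+ d ℚ.* (a ℚ.- c) ∣
      ≤⟨ ℚ.∣p+q∣≤∣p∣+∣q∣ (a ℚ.* (b ℚ.- d)) (d ℚ.* (a ℚ.- c)) ⟩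
    ℚ.∣ a ℚ.* (b ℚ.- d) ∣ ℚ.+ ℚ.∣ d ℚ.* (a ℚ.- c) ∣
      <⟨ ℚ.+-mono-< (product-bound a (b ℚ.- d) 0<B a≤B q) (product-bound d (a ℚ.- c) 0<C d≤C p) ⟩
    B ℚ.* δ ℚ.+ C ℚ.* δ
      ≡⟨ sym (ℚ.*-distribʳ-+ δ B C) ⟩
    (B ℚ.+ C) ℚ.* δ ∎
    where
    split : ∀ a b c d → a ℚ.* b ℚ.- c ℚ.* d ≡ a ℚ.* (b ℚ.- d) ℚ.+ d ℚ.* (a ℚ.- c)
    split = solve 4 (λ a b c d → a :* b :- c :* d := a :* (b :- d) :+ d :* (a :- c)) refl
      where open +-*-Solver

  near-bound : ∀ a b → ℚ.∣ a ℚ.- b ∣ ℚ.< 1ℚ → ℚ.∣ a ∣ ℚ.≤ 1ℚ ℚ.+ ℚ.∣ b ∣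
  near-bound a b p = begin
    ℚ.∣ a ∣                       ≡⟨ cong ℚ.∣_∣ (split a b) ⟩
    ℚ.∣ (a ℚ.- b) ℚ.+ b ∣         ≤⟨ ℚ.∣p+q∣≤∣p∣+∣q∣ (a ℚ.- b) b ⟩
    ℚ.∣ a ℚ.- b ∣ ℚ.+ ℚ.∣ b ∣     ≤⟨ ℚ.+-monoˡ-≤ ℚ.∣ b ∣ (ℚ.<⇒≤ p) ⟩
    1ℚ ℚ.+ ℚ.∣ b ∣                ∎
    where
    split : ∀ a b → a ≡ (a ℚ.- b) ℚ.+ b
    split = solve 2 (λ a b → a := (a :- b) :+ b) refl
      where open +-*-Solver

  0<½*ε : ∀ {ε} → 0ℚ ℚ.< ε → 0ℚ ℚ.< ½ ℚ.* ε
  0<½*ε {ε} 0<ε = subst (ℚ._< ½ ℚ.* ε) (ℚ.*-zeroʳ ½) (ℚ.*-monoʳ-<-pos ½ 0<ε)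

  quotient : ∀ B ε → 0ℚ ℚ.< B → 0ℚ ℚ.< ε → ∃[ δ ] (0ℚ ℚ.< δ × B ℚ.* δ ≡ ε)
  quotient B ε 0<B 0<ε = 1/B ℚ.* ε
    , subst (ℚ._< 1/B ℚ.* ε) (ℚ.*-zeroʳ 1/B)
        (ℚ.*-monoʳ-<-pos 1/B {{ℚ.1/pos⇒pos B {{B-pos}}}} 0<ε)
    , trans (sym (ℚ.*-assoc B 1/B ε))
        (trans (cong (ℚ._* ε) (ℚ.*-inverseʳ B {{B-nonZero}})) (ℚ.*-identityˡ ε))
    where
    B-pos : ℚ.Positive B
    B-pos = ℚ.positive 0<B
    B-nonZero : ℚ.NonZero B
    B-nonZero = ℚ.pos⇒nonZero B {{B-pos}}
    1/B : ℚ
    1/B = ℚ.1/_ B {{B-nonZero}}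

  left : ∀ M N {m} → M ⊔ N ℕ.≤ m → M ℕ.≤ m
  left M N = ℕ.m⊔n≤o⇒m≤o M N

  right : ∀ M N {m} → M ⊔ N ℕ.≤ m → N ℕ.≤ m
  right M N = ℕ.m⊔n≤o⇒n≤o M N

  const-cauchy : ∀ q → IsCauchy (λ _ → q)
  const-cauchy q ε 0<ε = 0 , λ _ _ _ _ → subst (λ d → ℚ.∣ d ∣ ℚ.< ε) (sym (ℚ.+-inverseʳ q)) 0<ε

  sub-cauchy : ∀ x y → IsCauchy x → IsCauchy y → IsCauchy (λ n → x n ℚ.- y n)
  sub-cauchy x y cx cy ε 0<ε =
    let (M , hx) = cx (½ ℚ.* ε) (0<½*ε 0<ε)
        (N , hy) = cy (½ ℚ.* ε) (0<½*ε 0<ε)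
    in M ⊔ N , λ m n p q →
         sub-close (x m) (y m) (x n) (y n)
           (hx m n (left M N p) (left M N q)) (hy m n (right M N p) (right M N q))

  EventuallyBounded : (ℕ → ℚ) → Set
  EventuallyBounded x = ∃[ B ] (0ℚ ℚ.< B × ∃[ N ] (∀ n → N ℕ.≤ n → ℚ.∣ x n ∣ ℚ.≤ B))

  bounded : ∀ x → IsCauchy x → EventuallyBounded x
  bounded x cx =
    let (N , h) = cx 1ℚ (ℚ.positive⁻¹ 1ℚ)
    in 1ℚ ℚ.+ ℚ.∣ x N ∣
     , ℚ.+-mono-<-≤ (ℚ.positive⁻¹ 1ℚ) (ℚ.0≤∣p∣ (x N))
     , N , λ n N≤n → near-bound (x n) (x N) (h n N N≤n ℕ.≤-refl)

  mul-cauchy : ∀ x y → IsCauchy x → IsCauchy y → IsCauchy (λ n → x n ℚ.* y n)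
  mul-cauchy x y cx cy ε 0<ε = go (bounded x cx) (bounded y cy)
    where
    go : EventuallyBounded x → EventuallyBounded y →
         ∃[ K ] (∀ m n → K ℕ.≤ m → K ℕ.≤ n → ℚ.∣ x m ℚ.* y m ℚ.- x n ℚ.* y n ∣ ℚ.< ε)
    go (B , 0<B , L , hB) (C , 0<C , M , hC) =
      let (δ , 0<δ , eq) = quotient (B ℚ.+ C) ε (ℚ.+-mono-< 0<B 0<C) 0<ε
          (N , hx) = cx δ 0<δ
          (O , hy) = cy δ 0<δ
      in (L ⊔ M) ⊔ (N ⊔ O) , λ m n p q →
           subst (ℚ.∣ x m ℚ.* y m ℚ.- x n ℚ.* y n ∣ ℚ.<_) eq
             (mul-close (x m) (y m) (x n) (y n) 0<B 0<C
               (hB m (left L M (left (L ⊔ M) (N ⊔ O) p)))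
               (hC n (right L M (left (L ⊔ M) (N ⊔ O) q)))
               (hx m n (left N O (right (L ⊔ M) (N ⊔ O) p)) (left N O (right (L ⊔ M) (N ⊔ O) q)))
               (hy m n (right N O (right (L ⊔ M) (N ⊔ O) p)) (right N O (right (L ⊔ M) (N ⊔ O) q))))

0ℝ : ℝ
0ℝ = mkℝ (λ _ → 0ℚ) (const-cauchy 0ℚ)

infixl 6 _-_
infixl 7 _*_

_-_ : ℝ → ℝ → ℝ
x - y = mkℝ (λ n → seq x n ℚ.- seq y n) (sub-cauchy (seq x) (seq y) (cauchy x) (cauchy y))

_*_ : ℝ → ℝ → ℝ
x * y = mkℝ (λ n → seq x n ℚ.* seq y n) (mul-cauchy (seq x) (seq y) (cauchy x) (cauchy y))

Point : Set
Point = ℝ × ℝ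

infix 4 _≈ₚ_

_≈ₚ_ : Point → Point → Set
(x₁ , y₁) ≈ₚ (x₂ , y₂) = x₁ ≈ x₂ × y₁ ≈ y₂

-- The cross product (b - a) × (c - a).  For a ≠ b, the line through a and b
-- is the set of c where it vanishes, and the two open half-planes determined
-- by that line are the sets of c where it is positive and negative.

cross : Point → Point → Point → ℝ
cross (ax , ay) (bx , by) (cx , cy) = (bx - ax) * (cy - ay) - (by - ay) * (cx - ax)

OnLine LeftOf RightOf : Point → Point → Point → Set
OnLine  a b c = cross a b c ≈ 0ℝ
LeftOf  a b c = 0ℝ < cross a b c
RightOf a b c = cross a b c < 0ℝ

-- Exactly k of the indices i satisfy Q.  Membership in an open half-plane is
-- not decidable over ℝ, so the set being counted is given as a Subset.

ExactlyMany : ∀ {n} → ℕ → (Fin n → Set) → Set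
ExactlyMany {n} k Q = ∃[ S ] (∣ S ∣ ≡ k × (∀ (i : Fin n) → i ∈ S ⇔ Q i))

-- A set of n points is given by an enumeration P : Fin n → Point, required
-- to be injective up to _≈ₚ_ in the theorem; subsets of it and its underlying
-- graph live on the index set Fin n.

module _ {n : ℕ} (P : Fin n → Point) where

  GeneralPosition : Set
  GeneralPosition = ∀ i j k → i ≢ j → i ≢ k → j ≢ k → ¬ OnLine (P i) (P j) (P k)

  IsHalvingLine : Fin n → Fin n → Set
  IsHalvingLine i j = i ≢ j
    × ExactlyMany ((n ∸ 2) / 2) (λ k → LeftOf  (P i) (P j) (P k))
    × ExactlyMany ((n ∸ 2) / 2) (λ k → RightOf (P i) (P j) (P k))

  Adjacent : Fin n → Fin n → Set
  Adjacent = IsHalvingLine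

  -- Joined by a path in the underlying graph (Adjacent is symmetric because
  -- cross a b c = - cross b a c).
  Connected : Fin n → Fin n → Set
  Connected = Star Adjacent

  -- A is the union of the components of the vertices in some set B.
  IsUnionOfComponents : Subset n → Set
  IsUnionOfComponents A =
    ∃[ B ] (∀ i → i ∈ A ⇔ (∃[ b ] (b ∈ B × Connected b i)))

{-# OPTIONS --safe #-}

-- The union A of components keeps its balance while a line rotates.  Sweep the
-- directions of the plane: the points of A in the lower half change only when
-- the two median points swap, and those two span a halving line, so both or
-- neither of them lie in A.  After half a turn the halves are exchanged, hence
-- each half contains as many points of A as the other.
--
-- The sweep is carried out at one point i at a time, where the lines through i
-- are totally ordered by slope: i enters or leaves the lower half exactly at
-- the halving lines ij.  In the sum over i ∈ A each halving line is counted
-- once with each sign.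
--
-- The equality of two natural numbers is ¬¬-stable, so all orientations may be
-- assumed decided; they are then the orientations of rational points, namely
-- the m-th terms of the Cauchy sequences for m large.  The initial direction
-- is a small perturbation of ab for which no two points are level.
module Submission where

open import Defs using (ℝ; seq; cauchy; 0ℝ; _≈_; Point; _≈ₚ_; cross; LeftOf; RightOf; ExactlyMany;
  GeneralPosition; IsHalvingLine; Adjacent; IsUnionOfComponents)
import Defs as ℝ
open import Data.Bool using (if_then_else_)
open import Data.Fin as Fin using (Fin; zero; suc)
import Data.Fin.Properties as Fin
open import Data.Fin.Subset using (Subset; _∈_; _∩_; ∣_∣; inside; outside)
open import Data.Fin.Subset.Properties using (_∈?_; x∈p∩q⁺; x∈p∩q⁻; p∩q⊆q; p⊆q⇒∣p∣≤∣q∣)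
open import Data.List using (List; []; _∷_; map; _++_; _∷ʳ_; [_]; allFin)
open import Data.List.Properties using (map-++; ∷ʳ-++; map-tabulate)
open import Data.List.Relation.Binary.Permutation.Propositional using (_↭_; ↭-sym; ↭⇒↭ₛ)
open import Data.List.Relation.Binary.Permutation.Propositional.Properties using (map⁺)
import Data.List.Relation.Binary.Permutation.Setoid.Properties as Permutation
open import Data.List.Relation.Unary.All as All using (All; []; _∷_)
open import Data.List.Relation.Unary.AllPairs as AllPairs using (AllPairs; _∷_)
open import Data.List.Relation.Unary.Sorted.TotalOrder.Properties using (Sorted⇒AllPairs)
open import Data.List.Relation.Unary.Unique.Propositional.Properties using (allFin⁺)
import Data.List.Sort as Sort
open import Data.Nat as ℕ using (ℕ; zero; suc; _+_; _*_; _≤_; z≤n; _<?_; _≟_; _⊔_)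
open import Data.Nat.Divisibility using (_∣_; divides)
open import Data.Nat.DivMod using (_/_; m*n/n≡m)
open import Data.Nat.ListAction using (sum)
open import Data.Nat.ListAction.Properties using (sum-++; sum-↭)
open import Data.Nat.Properties
open import Algebra.Properties.CommutativeSemigroup +-commutativeSemigroup using (interchange; x∙yz≈y∙xz)
import Data.Nat.Solver as ℕ
open import Data.Product using (_×_; _,_; proj₁; proj₂; ∃-syntax)
open import Data.Rational as ℚ using (ℚ; 0ℚ; 1ℚ; ½)
import Data.Rational.Properties as ℚ
open import Data.Rational.Solver using (module +-*-Solver)
open import Data.Sum as Sum using (_⊎_; inj₁; inj₂; [_,_]′)
open import Data.Vec using ([]; _∷_; tabulate)
open import Data.Vec.Properties using (lookup⇒[]=; []=⇒lookup; lookup∘tabulate)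
open import Effect.Monad using (RawMonad)
open import Function using (_∘_; case_of_; flip; _⇔_; mk⇔; Equivalence)
open import Function.Definitions using (Injective)
open import Function.Construct.Composition using (_⇔-∘_)
open import Function.Construct.Symmetry using (⇔-sym)
open import Relation.Binary.Bundles using (DecTotalOrder)
open import Relation.Binary.Construct.Closure.ReflexiveTransitive using (ε; _◅_; _◅◅_)
import Relation.Binary.Construct.On as On
open import Relation.Binary.Definitions using (tri<; tri≈; tri>; Asymmetric)
open import Relation.Binary.PropositionalEquality hiding ([_])
open import Relation.Nullary using (¬_; Dec; yes; no; does; contradiction; DoubleNegation)
open import Relation.Nullary.Decidable using (_⊎-dec_; _×-dec_; decidable-stable; dec-true; dec-false)
open import Relation.Nullary.Negation using (¬¬-map; ¬¬-Monad)

open Equivalence using (to; from)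

private variable
  A B P Q : Set

-- Finite sums of indicators

𝟙 : Dec P → ℕ
𝟙 P? = if does P? then 1 else 0

𝟙-yes : (P? : Dec P) → P → 𝟙 P? ≡ 1
𝟙-yes P? p rewrite dec-true P? p = refl

𝟙-no : (P? : Dec P) → ¬ P → 𝟙 P? ≡ 0
𝟙-no P? ¬p rewrite dec-false P? ¬p = refl

𝟙-cong : (P? : Dec P) (Q? : Dec Q) → (P → Q) → (Q → P) → 𝟙 P? ≡ 𝟙 Q?
𝟙-cong (yes p) Q? f g = sym (𝟙-yes Q? (f p))
𝟙-cong (no ¬p) Q? f g = sym (𝟙-no Q? (¬p ∘ g))

𝟙-mono : (P? : Dec P) (Q? : Dec Q) → (P → Q) → 𝟙 P? ≤ 𝟙 Q?
𝟙-mono (yes p) Q? f = ≤-reflexive (sym (𝟙-yes Q? (f p)))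
𝟙-mono (no ¬p) Q? f = z≤n

𝟙-*-cong : ∀ (P? : Dec P) {x y} → (P → x ≡ y) → 𝟙 P? * x ≡ 𝟙 P? * y
𝟙-*-cong (yes p) f = cong (1 *_) (f p)
𝟙-*-cong (no _)  f = refl

∑ : List A → (A → ℕ) → ℕ
∑ xs f = sum (map f xs)

∑-cong : ∀ (xs : List A) {f g : A → ℕ} → f ≗ g → ∑ xs f ≡ ∑ xs g
∑-cong []       eq = refl
∑-cong (x ∷ xs) eq = cong₂ _+_ (eq x) (∑-cong xs eq)

∑-cong-All : ∀ {xs : List A} {f g : A → ℕ} → All (λ x → f x ≡ g x) xs → ∑ xs f ≡ ∑ xs g
∑-cong-All []         = refl
∑-cong-All (eq ∷ eqs) = cong₂ _+_ eq (∑-cong-All eqs)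

∑-mono : ∀ (xs : List A) {f g : A → ℕ} → (∀ x → f x ≤ g x) → ∑ xs f ≤ ∑ xs g
∑-mono []       le = z≤n
∑-mono (x ∷ xs) le = +-mono-≤ (le x) (∑-mono xs le)

∑-++ : ∀ (xs ys : List A) (f : A → ℕ) → ∑ (xs ++ ys) f ≡ ∑ xs f + ∑ ys f
∑-++ xs ys f = trans (cong sum (map-++ f xs ys)) (sum-++ (map f xs) (map f ys))

∑-↭ : ∀ {xs ys : List A} (f : A → ℕ) → xs ↭ ys → ∑ xs f ≡ ∑ ys f
∑-↭ f p = sum-↭ (map⁺ f p)

∑-zero : ∀ (xs : List A) → ∑ xs (λ _ → 0) ≡ 0
∑-zero []       = refl
∑-zero (x ∷ xs) = ∑-zero xs

∑-+ : ∀ (xs : List A) (f g : A → ℕ) → ∑ xs (λ x → f x + g x) ≡ ∑ xs f + ∑ xs g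
∑-+ []       f g = refl
∑-+ (x ∷ xs) f g = trans (cong (f x + g x +_) (∑-+ xs f g)) (interchange (f x) (g x) _ _)

∑-* : ∀ (xs : List A) c (f : A → ℕ) → ∑ xs (λ x → c * f x) ≡ c * ∑ xs f
∑-* []       c f = sym (*-zeroʳ c)
∑-* (x ∷ xs) c f = trans (cong (c * f x +_) (∑-* xs c f)) (sym (*-distribˡ-+ c _ _))

∑-swap : ∀ (xs : List A) (ys : List B) (f : A → B → ℕ) →
         ∑ xs (λ x → ∑ ys (f x)) ≡ ∑ ys (λ y → ∑ xs (λ x → f x y))
∑-swap []       ys f = sym (∑-zero ys)
∑-swap (x ∷ xs) ys f = trans (cong (∑ ys (f x) +_) (∑-swap xs ys f)) (sym (∑-+ ys (f x) _))

∑-suc : ∀ {n} (f : Fin (suc n) → ℕ) → ∑ (allFin (suc n)) f ≡ f zero + ∑ (allFin n) (f ∘ suc)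
∑-suc f = cong (λ l → f zero + sum l) (trans (map-tabulate suc f) (sym (map-tabulate (λ i → i) (f ∘ suc))))

∑-one : ∀ n → ∑ (allFin n) (λ _ → 1) ≡ n
∑-one zero    = refl
∑-one (suc n) = trans (∑-suc {n} (λ _ → 1)) (cong suc (∑-one n))

∑-δ : ∀ {n} (i : Fin n) → ∑ (allFin n) (λ j → 𝟙 (j Fin.≟ i)) ≡ 1
∑-δ {suc n} zero    = trans (∑-suc {n} (λ j → 𝟙 (j Fin.≟ zero))) (cong suc (∑-zero (allFin n)))
∑-δ {suc n} (suc i) = trans (∑-suc (λ j → 𝟙 (j Fin.≟ suc i)))
  (trans (∑-cong (allFin n) λ j → 𝟙-cong (suc j Fin.≟ suc i) (j Fin.≟ i) Fin.suc-injective (cong suc)) (∑-δ i))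

-- Lists split at an entry, and walks crossing a level

AllPairs-split : ∀ {R : A → A → Set} pre {x post} → AllPairs R (pre ++ x ∷ post) →
                 All (λ y → R y x) pre × All (R x) post
AllPairs-split []        (rs ∷ _)  = [] , rs
AllPairs-split (y ∷ pre) (rs ∷ ap) =
  let (l , r) = AllPairs-split pre ap in All-at pre rs ∷ l , r
  where
  All-at : ∀ {Q : A → Set} pre {x post} → All Q (pre ++ x ∷ post) → Q x
  All-at []        (q ∷ _)  = q
  All-at (_ ∷ pre) (_ ∷ qs) = All-at pre qs

-- A unit step up from ℓ leads from "at most h" to "more than h" only when it starts at h itself.
step : ∀ h ℓ (P? : Dec P) → 𝟙 (h <? 𝟙 P? + ℓ) ≡ 𝟙 (h <? ℓ) + 𝟙 P? * 𝟙 (ℓ ≟ h)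
step h ℓ (no _)  = sym (+-identityʳ _)
step h ℓ (yes _) with <-cmp ℓ h
... | tri< ℓ<h ℓ≢h _ = trans (𝟙-no (h <? suc ℓ) (λ h≤ℓ → <-irrefl refl (<-≤-trans ℓ<h (≤-pred h≤ℓ))))
      (sym (cong₂ _+_ (𝟙-no (h <? ℓ) (<-asym ℓ<h)) (cong (1 *_) (𝟙-no (ℓ ≟ h) ℓ≢h))))
... | tri≈ ℓ≮h refl _ = trans (𝟙-yes (h <? suc ℓ) ≤-refl)
      (sym (cong₂ _+_ (𝟙-no (h <? ℓ) ℓ≮h) (cong (1 *_) (𝟙-yes (ℓ ≟ h) refl))))
... | tri> _ ℓ≢h h<ℓ = trans (𝟙-yes (h <? suc ℓ) (m<n⇒m<1+n h<ℓ))
      (sym (cong₂ _+_ (𝟙-yes (h <? ℓ) h<ℓ) (cong (1 *_) (𝟙-no (ℓ ≟ h) ℓ≢h))))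

module Walk {A : Set} {P Q : A → Set} (P? : ∀ x → Dec (P x)) (Q? : ∀ x → Dec (Q x)) (h : ℕ) where

  p q : A → ℕ
  p x = 𝟙 (P? x)
  q x = 𝟙 (Q? x)

  -- Each x of type P steps down and each x of type Q steps up; ℓ x is the
  -- lower end of the step made at x.
  crossings : ∀ (ℓ : A → ℕ) xs →
    (∀ pre x post → xs ≡ pre ++ x ∷ post → P x ⊎ Q x → ℓ x ≡ ∑ pre q + ∑ post p) →
    𝟙 (h <? ∑ xs q) + ∑ xs (λ x → p x * 𝟙 (ℓ x ≟ h)) ≡
    𝟙 (h <? ∑ xs p) + ∑ xs (λ x → q x * 𝟙 (ℓ x ≟ h))
  crossings ℓ xs hyp = go [] xs refl
    where
    open ≡-Reasoning

    E : A → ℕ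
    E x = 𝟙 (ℓ x ≟ h)

    -- Induction on the part still to be walked: once `pre` is done, the walk stands at
    -- `∑ pre q + ∑ post p`, and only the remaining steps are counted.
    go : ∀ pre post → xs ≡ pre ++ post →
         𝟙 (h <? ∑ pre q + ∑ post q) + ∑ post (λ x → p x * E x) ≡
         𝟙 (h <? ∑ pre q + ∑ post p) + ∑ post (λ x → q x * E x)
    go pre []         eq = refl
    go pre (x ∷ post) eq = begin
      𝟙 (h <? ∑ pre q + (q x + ∑ post q)) + (p x * E x + ∑ post (λ x → p x * E x))
        ≡⟨ cong (λ s → 𝟙 (h <? s) + (p x * E x + ∑ post (λ x → p x * E x))) (shift (∑ post q)) ⟩
      𝟙 (h <? ∑ (pre ∷ʳ x) q + ∑ post q) + (p x * E x + ∑ post (λ x → p x * E x))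
        ≡⟨ x∙yz≈y∙xz (𝟙 (h <? ∑ (pre ∷ʳ x) q + ∑ post q)) (p x * E x) (∑ post (λ y → p y * E y)) ⟩
      p x * E x + (𝟙 (h <? ∑ (pre ∷ʳ x) q + ∑ post q) + ∑ post (λ x → p x * E x))
        ≡⟨ cong (p x * E x +_) (go (pre ∷ʳ x) post (trans eq (sym (∷ʳ-++ pre x post)))) ⟩
      p x * E x + (𝟙 (h <? ∑ (pre ∷ʳ x) q + ∑ post p) + ∑ post (λ x → q x * E x))
        ≡⟨ cong (λ s → p x * E x + (𝟙 (h <? s) + ∑ post (λ x → q x * E x))) (sym (trans (x∙yz≈y∙xz (q x) (∑ pre q) (∑ post p)) (shift (∑ post p)))) ⟩
      p x * E x + (𝟙 (h <? q x + L) + ∑ post (λ x → q x * E x))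
        ≡⟨ cong (λ s → p x * E x + (s + ∑ post (λ x → q x * E x))) (step′ (Q? x) inj₂) ⟩
      p x * E x + (𝟙 (h <? L) + q x * E x + ∑ post (λ x → q x * E x))
        ≡⟨ solve 4 (λ a b c d → a :+ (b :+ c :+ d) := (b :+ a) :+ (c :+ d)) refl (p x * E x) (𝟙 (h <? L)) _ _ ⟩
      𝟙 (h <? L) + p x * E x + (q x * E x + ∑ post (λ x → q x * E x))
        ≡⟨ cong (_+ (q x * E x + ∑ post (λ x → q x * E x))) (sym (step′ (P? x) inj₁)) ⟩
      𝟙 (h <? p x + L) + (q x * E x + ∑ post (λ x → q x * E x))
        ≡⟨ cong (λ s → 𝟙 (h <? s) + (q x * E x + ∑ post (λ x → q x * E x))) (x∙yz≈y∙xz (p x) (∑ pre q) (∑ post p)) ⟩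
      𝟙 (h <? ∑ pre q + (p x + ∑ post p)) + (q x * E x + ∑ post (λ x → q x * E x)) ∎
      where
      open ℕ.+-*-Solver

      L : ℕ
      L = ∑ pre q + ∑ post p

      shift : ∀ s → ∑ pre q + (q x + s) ≡ ∑ (pre ∷ʳ x) q + s
      shift s = trans (sym (+-assoc (∑ pre q) (q x) s))
        (cong (_+ s) (sym (trans (∑-++ pre [ x ] q) (cong (∑ pre q +_) (+-identityʳ (q x))))))

      -- The hypothesis on ℓ is available only where a step is made; elsewhere the factor `𝟙 R?`
      -- vanishes.
      step′ : ∀ {R : Set} (R? : Dec R) → (R → P x ⊎ Q x) → 𝟙 (h <? 𝟙 R? + L) ≡ 𝟙 (h <? L) + 𝟙 R? * E x
      step′ R? f = trans (step h L R?) (cong (𝟙 (h <? L) +_)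
        (𝟙-*-cong R? λ r → cong (λ l → 𝟙 (l ≟ h)) (sym (hyp pre x post eq (f r)))))

-- Rotating a line about a point

p<q⇒0<q-p : ∀ {p q} → p ℚ.< q → 0ℚ ℚ.< q ℚ.- p
p<q⇒0<q-p {p} {q} p<q = subst (ℚ._< q ℚ.- p) (ℚ.+-inverseʳ p) (ℚ.+-monoˡ-< (ℚ.- p) p<q)

0<q-p⇒p<q : ∀ {p q} → 0ℚ ℚ.< q ℚ.- p → p ℚ.< q
0<q-p⇒p<q {p} {q} 0<q-p = subst₂ ℚ._<_ (ℚ.+-identityˡ p)
  (solve 2 (λ p q → q :- p :+ p := q) refl p q) (ℚ.+-monoˡ-< p 0<q-p)
  where open +-*-Solver

p≤q⇒0≤q-p : ∀ {p q} → p ℚ.≤ q → 0ℚ ℚ.≤ q ℚ.- p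
p≤q⇒0≤q-p {p} {q} p≤q = subst (ℚ._≤ q ℚ.- p) (ℚ.+-inverseʳ p) (ℚ.+-monoˡ-≤ (ℚ.- p) p≤q)

p-q≡0⇒p≡q : ∀ {p q} → p ℚ.- q ≡ 0ℚ → p ≡ q
p-q≡0⇒p≡q {p} {q} eq = trans (solve 2 (λ p q → p := p :- q :+ q) refl p q)
  (trans (cong (ℚ._+ q) eq) (ℚ.+-identityˡ q))
  where open +-*-Solver

0<-⇒<0 : ∀ {p} → 0ℚ ℚ.< ℚ.- p → p ℚ.< 0ℚ
0<-⇒<0 {p} lt = subst (ℚ._< 0ℚ) (solve 1 (λ p → :- (:- p) := p) refl p) (ℚ.neg-antimono-< lt)
  where open +-*-Solver

0<⇒≢0 : ∀ {p} → 0ℚ ℚ.< p → p ≢ 0ℚ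
0<⇒≢0 0<p refl = ℚ.<-irrefl refl 0<p

0<p*q : ∀ {p q} → 0ℚ ℚ.< p → 0ℚ ℚ.< q → 0ℚ ℚ.< p ℚ.* q
0<p*q {p} {q} 0<p 0<q = ℚ.positive⁻¹ (p ℚ.* q) {{ℚ.pos*pos⇒pos p {{ℚ.positive 0<p}} q {{ℚ.positive 0<q}}}}

0<p∧0<p*q⇒0<q : ∀ {p q} → 0ℚ ℚ.< p → 0ℚ ℚ.< p ℚ.* q → 0ℚ ℚ.< q
0<p∧0<p*q⇒0<q {p} {q} 0<p 0<pq = ℚ.*-cancelˡ-<-nonNeg p {{ℚ.nonNegative (ℚ.<⇒≤ 0<p)}}
  (subst (ℚ._< p ℚ.* q) (sym (ℚ.*-zeroʳ p)) 0<pq)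

p*q≡0∧p≢0⇒q≡0 : ∀ {p q} → p ℚ.* q ≡ 0ℚ → p ≢ 0ℚ → q ≡ 0ℚ
p*q≡0∧p≢0⇒q≡0 {p} {q} eq p≢0 = begin
  q                      ≡⟨ ℚ.*-identityˡ q ⟨
  1ℚ ℚ.* q               ≡⟨ cong (ℚ._* q) (ℚ.*-inverseˡ p) ⟨
  (ℚ.1/ p) ℚ.* p ℚ.* q   ≡⟨ ℚ.*-assoc (ℚ.1/ p) p q ⟩
  (ℚ.1/ p) ℚ.* (p ℚ.* q) ≡⟨ cong ((ℚ.1/ p) ℚ.*_) eq ⟩
  (ℚ.1/ p) ℚ.* 0ℚ        ≡⟨ ℚ.*-zeroʳ (ℚ.1/ p) ⟩
  0ℚ                     ∎
  where
  open ≡-Reasoning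
  instance nz = ℚ.≢-nonZero p≢0

-- Division made total by the default 0, so that `slope` is defined at every index, including the
-- centre of rotation.
divide : ∀ p q → ∃[ t ] (p ≢ 0ℚ → p ℚ.* t ≡ q)
divide p q with p ℚ.≟ 0ℚ
... | yes p≡0 = 0ℚ , λ p≢0 → contradiction p≡0 p≢0
... | no  p≢0 = (ℚ.1/ p) ℚ.* q , λ _ → trans (sym (ℚ.*-assoc p (ℚ.1/ p) q))
                  (trans (cong (ℚ._* q) (ℚ.*-inverseʳ p)) (ℚ.*-identityˡ q))
  where instance nz = ℚ.≢-nonZero p≢0

-- As D is nonzero, s and t differ, so `t - s` is positive and D has the sign of c. Ties between
-- slopes are thus excluded by general position.
sign-≤ : ∀ {a c s t D} → 0ℚ ℚ.< a → s ℚ.≤ t → D ≡ a ℚ.* (c ℚ.* (t ℚ.- s)) → D ≢ 0ℚ →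
         (0ℚ ℚ.< D → 0ℚ ℚ.< c) × (0ℚ ℚ.< c → 0ℚ ℚ.< D)
sign-≤ {a} {c} {s} {t} 0<a s≤t refl D≢0 = D⇒c , c⇒D
  where
  0<t-s : 0ℚ ℚ.< t ℚ.- s
  0<t-s with ℚ.<-cmp 0ℚ (t ℚ.- s)
  ... | tri< lt _ _ = lt
  ... | tri≈ _ eq _ = contradiction
        (trans (cong (λ e → a ℚ.* (c ℚ.* e)) (sym eq)) (trans (cong (a ℚ.*_) (ℚ.*-zeroʳ c)) (ℚ.*-zeroʳ a))) D≢0
  ... | tri> _ _ gt = contradiction (ℚ.≤-<-trans (p≤q⇒0≤q-p s≤t) gt) (ℚ.<-irrefl refl)

  D⇒c : 0ℚ ℚ.< a ℚ.* (c ℚ.* (t ℚ.- s)) → 0ℚ ℚ.< c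
  D⇒c lt = 0<p∧0<p*q⇒0<q 0<t-s (subst (0ℚ ℚ.<_) (ℚ.*-comm c (t ℚ.- s)) (0<p∧0<p*q⇒0<q 0<a lt))

  c⇒D : 0ℚ ℚ.< c → 0ℚ ℚ.< a ℚ.* (c ℚ.* (t ℚ.- s))
  c⇒D 0<c = 0<p*q 0<a (0<p*q 0<c 0<t-s)

module _ {n : ℕ} (X Y : Fin n → ℚ) where

  det : Fin n → Fin n → Fin n → ℚ
  det i j k = (X j ℚ.- X i) ℚ.* (Y k ℚ.- Y i) ℚ.- (Y j ℚ.- Y i) ℚ.* (X k ℚ.- X i)

  leftCount : Fin n → Fin n → ℕ
  leftCount i j = ∑ (allFin n) λ k → 𝟙 (0ℚ ℚ.<? det i j k)

  det-swap : ∀ i j k → det j i k ≡ ℚ.- det i j k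
  det-swap i j k = solve 6 (λ xi yi xj yj xk yk →
    (xi :- xj) :* (yk :- yj) :- (yi :- yj) :* (xk :- xj) :=
    :- ((xj :- xi) :* (yk :- yi) :- (yj :- yi) :* (xk :- xi))) refl (X i) (Y i) (X j) (Y j) (X k) (Y k)
    where open +-*-Solver

  det-iji : ∀ i j → det i j i ≡ 0ℚ
  det-iji i j = solve 4 (λ xi yi xj yj → (xj :- xi) :* (yi :- yi) :- (yj :- yi) :* (xi :- xi) := con 0ℚ)
    refl (X i) (Y i) (X j) (Y j)
    where open +-*-Solver

  det-ijj : ∀ i j → det i j j ≡ 0ℚ
  det-ijj i j = solve 4 (λ xi yi xj yj → (xj :- xi) :* (yj :- yi) :- (yj :- yi) :* (xj :- xi) := con 0ℚ)
    refl (X i) (Y i) (X j) (Y j)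
    where open +-*-Solver

  NoThreeCollinear : Set
  NoThreeCollinear = ∀ i j k → i ≢ j → i ≢ k → j ≢ k → det i j k ≢ 0ℚ

  module Rotation (gp : NoThreeCollinear) where

    -- By general position each other point lies on exactly one side, and exchanging i and j negates
    -- the determinant. The points i and j account for the 2.
    left+right : ∀ {i j} → i ≢ j → leftCount i j + leftCount j i + 2 ≡ n
    left+right {i} {j} i≢j = begin
      leftCount i j + leftCount j i + 2
        ≡⟨ cong₂ _+_ (sym (∑-+ (allFin n) _ _)) (sym (trans (∑-+ (allFin n) _ _) (cong₂ _+_ (∑-δ i) (∑-δ j)))) ⟩
      ∑ (allFin n) (λ k → 𝟙 (0ℚ ℚ.<? det i j k) + 𝟙 (0ℚ ℚ.<? det j i k)) +
      ∑ (allFin n) (λ k → 𝟙 (k Fin.≟ i) + 𝟙 (k Fin.≟ j))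
        ≡⟨ sym (∑-+ (allFin n) _ _) ⟩
      ∑ (allFin n) (λ k → 𝟙 (0ℚ ℚ.<? det i j k) + 𝟙 (0ℚ ℚ.<? det j i k) + (𝟙 (k Fin.≟ i) + 𝟙 (k Fin.≟ j)))
        ≡⟨ ∑-cong (allFin n) pointwise ⟩
      ∑ (allFin n) (λ _ → 1)
        ≡⟨ ∑-one n ⟩
      n ∎
      where
      open ≡-Reasoning

      zeros : ∀ k → det i j k ≡ 0ℚ → 𝟙 (0ℚ ℚ.<? det i j k) + 𝟙 (0ℚ ℚ.<? det j i k) ≡ 0
      zeros k eq = cong₂ _+_ (𝟙-no (0ℚ ℚ.<? det i j k) (λ lt → 0<⇒≢0 lt eq))
        (𝟙-no (0ℚ ℚ.<? det j i k) (λ lt → 0<⇒≢0 lt (trans (det-swap i j k) (cong ℚ.-_ eq))))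

      pointwise : ∀ k → 𝟙 (0ℚ ℚ.<? det i j k) + 𝟙 (0ℚ ℚ.<? det j i k) + (𝟙 (k Fin.≟ i) + 𝟙 (k Fin.≟ j)) ≡ 1
      pointwise k with k Fin.≟ i | k Fin.≟ j
      ... | yes k≡i  | yes k≡j = contradiction (trans (sym k≡i) k≡j) i≢j
      ... | yes refl | no _    = cong (_+ 1) (zeros k (det-iji i j))
      ... | no _     | yes refl = cong (_+ 1) (zeros k (det-ijj i j))
      ... | no k≢i   | no k≢j  = trans (+-identityʳ _) (case ℚ.<-cmp 0ℚ (det i j k) of λ where
        (tri< lt _ _) → cong₂ _+_ (𝟙-yes (0ℚ ℚ.<? det i j k) lt) (𝟙-no (0ℚ ℚ.<? det j i k)
           (λ lt′ → ℚ.<-asym lt (0<-⇒<0 (subst (0ℚ ℚ.<_) (det-swap i j k) lt′))))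
        (tri≈ _ eq _) → contradiction (sym eq) (gp i j k i≢j (k≢i ∘ sym) (k≢j ∘ sym))
        (tri> ≮ _ gt) → cong₂ _+_ (𝟙-no (0ℚ ℚ.<? det i j k) ≮) (𝟙-yes (0ℚ ℚ.<? det j i k)
           (subst (0ℚ ℚ.<_) (sym (det-swap i j k)) (ℚ.neg-antimono-< gt))))

    -- Of the n - 2 = h + h points off the line, h on one side leave h for the other; so the left
    -- count alone tells whether a line is halving.
    leftCount-sym : ∀ {h} → n ≡ h + h + 2 → ∀ {i j} → i ≢ j → leftCount i j ≡ h → leftCount j i ≡ h
    leftCount-sym {h} n≡ {i} {j} i≢j e = +-cancelˡ-≡ h _ _ (trans (cong (_+ leftCount j i) (sym e))
      (+-cancelʳ-≡ 2 _ _ (trans (left+right i≢j) n≡)))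

    module _ (i : Fin n) where

      slope : Fin n → ℚ
      slope j = proj₁ (divide (X j ℚ.- X i) (Y j ℚ.- Y i))

      -- Substituting Y = slope * X, relative to i, factors the determinant: an orientation at i
      -- depends only on the order of two slopes and on which points have larger X than i.
      det-slope : ∀ {j k} → X j ≢ X i → X k ≢ X i →
                  det i j k ≡ (X j ℚ.- X i) ℚ.* ((X k ℚ.- X i) ℚ.* (slope k ℚ.- slope j))
      det-slope {j} {k} xj≢ xk≢ = trans
        (cong₂ (λ p q → (X j ℚ.- X i) ℚ.* p ℚ.- q ℚ.* (X k ℚ.- X i)) (eq k xk≢) (eq j xj≢))
        (solve 4 (λ a c s t → a :* (c :* t) :- a :* s :* c := a :* (c :* (t :- s))) refl
          (X j ℚ.- X i) (X k ℚ.- X i) (slope j) (slope k))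
        where
        open +-*-Solver
        eq : ∀ l → X l ≢ X i → Y l ℚ.- Y i ≡ (X l ℚ.- X i) ℚ.* slope l
        eq l xl≢ = sym (proj₂ (divide (X l ℚ.- X i) (Y l ℚ.- Y i)) (xl≢ ∘ p-q≡0⇒p≡q))

      slopeOrder : DecTotalOrder _ _ _
      slopeOrder = On.decTotalOrder ℚ.≤-decTotalOrder slope

      bySlope : List (Fin n)
      bySlope = Sort.sort slopeOrder (allFin n)

      bySlope-↭ : bySlope ↭ allFin n
      bySlope-↭ = Sort.sort-↭ slopeOrder (allFin n)

      bySlope-sorted : AllPairs (λ j k → slope j ℚ.≤ slope k × j ≢ k) bySlope
      bySlope-sorted = AllPairs.zip
        ( Sorted⇒AllPairs (DecTotalOrder.totalOrder slopeOrder) (Sort.sort-↗ slopeOrder (allFin n))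
        , Permutation.Unique-resp-↭ (setoid (Fin n)) (↭⇒↭ₛ (↭-sym bySlope-↭)) (allFin⁺ n))

      module _ (X≢ : ∀ {j : Fin n} → j ≢ i → X j ≢ X i) (h : ℕ) where

        above? : ∀ k → Dec (X i ℚ.< X k)
        above? k = X i ℚ.<? X k

        below? : ∀ k → Dec (X k ℚ.< X i)
        below? k = X k ℚ.<? X i

        -- D k is det i x k if x is above i, and det x i k if x is below.
        splitCount : ∀ {x a} (D : Fin n → ℚ) → 0ℚ ℚ.< a →
          (∀ {k} → k ≢ i → D k ≡ a ℚ.* ((X k ℚ.- X i) ℚ.* (slope k ℚ.- slope x))) →
          D i ≡ 0ℚ → D x ≡ 0ℚ → (∀ {k} → k ≢ i → k ≢ x → D k ≢ 0ℚ) →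
          ∀ pre post → bySlope ≡ pre ++ x ∷ post →
          ∑ (allFin n) (λ k → 𝟙 (0ℚ ℚ.<? D k)) ≡ ∑ pre (𝟙 ∘ below?) + ∑ post (𝟙 ∘ above?)
        splitCount {x} {a} D 0<a D-eq Di Dx D≢0 pre post eq = begin
          ∑ (allFin n) d                              ≡⟨ ∑-↭ d bySlope-↭ ⟨
          ∑ bySlope d                                 ≡⟨ cong (λ l → ∑ l d) eq ⟩
          ∑ (pre ++ x ∷ post) d                       ≡⟨ ∑-++ pre (x ∷ post) d ⟩
          ∑ pre d + (d x + ∑ post d)                  ≡⟨ cong (λ e → ∑ pre d + (e + ∑ post d)) (𝟙-no (0ℚ ℚ.<? D x) λ lt → 0<⇒≢0 lt Dx) ⟩
          ∑ pre d + ∑ post d                          ≡⟨ cong₂ _+_ (∑-cong-All (All.map before (proj₁ sorted)))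
                                                                   (∑-cong-All (All.map after (proj₂ sorted))) ⟩
          ∑ pre (𝟙 ∘ below?) + ∑ post (𝟙 ∘ above?)    ∎
          where
          open ≡-Reasoning

          d : Fin n → ℕ
          d k = 𝟙 (0ℚ ℚ.<? D k)

          sorted = AllPairs-split pre (subst (AllPairs _) eq bySlope-sorted)

          dᵢ≡0 : d i ≡ 0
          dᵢ≡0 = 𝟙-no (0ℚ ℚ.<? D i) λ lt → 0<⇒≢0 lt Di

          -- Before x the slope difference has the opposite sign; reversing both factors gives the
          -- form of `sign-≤`, with `X i - X k` as the factor that decides.
          before : ∀ {k} → slope k ℚ.≤ slope x × k ≢ x → d k ≡ 𝟙 (below? k)
          before {k} (le , k≢x) with k Fin.≟ i
          -- The centre i is itself in the list, placed by its default slope, and contributes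
          -- nothing to either count.
          ... | yes refl = trans dᵢ≡0 (sym (𝟙-no (below? k) (ℚ.<-irrefl refl)))
          ... | no  k≢i  = 𝟙-cong (0ℚ ℚ.<? D k) (below? k) (0<q-p⇒p<q ∘ proj₁ sg) (proj₂ sg ∘ p<q⇒0<q-p)
            where
            open +-*-Solver
            sg = sign-≤ 0<a le (trans (D-eq k≢i) (cong (a ℚ.*_)
              (solve 4 (λ xk xi s t → (xk :- xi) :* (s :- t) := (xi :- xk) :* (t :- s)) refl (X k) (X i) (slope k) (slope x))))
              (D≢0 k≢i k≢x)

          after : ∀ {k} → slope x ℚ.≤ slope k × x ≢ k → d k ≡ 𝟙 (above? k)
          after {k} (le , x≢k) with k Fin.≟ i
          ... | yes refl = trans dᵢ≡0 (sym (𝟙-no (above? k) (ℚ.<-irrefl refl)))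
          ... | no  k≢i  = 𝟙-cong (0ℚ ℚ.<? D k) (above? k) (0<q-p⇒p<q ∘ proj₁ sg) (proj₂ sg ∘ p<q⇒0<q-p)
            where
            sg = sign-≤ 0<a le (D-eq k≢i) (D≢0 k≢i (x≢k ∘ sym))

        -- The line ij is directed towards increasing X, whichever of its ends is i, and the points
        -- on its left are counted.
        step-at : Fin n → ℕ
        step-at j with above? j
        ... | yes _ = leftCount i j
        ... | no  _ = leftCount j i

        -- With the line directed upwards, k is on its left when `X k - X i` and `slope k - slope x`
        -- have the same sign. If x is below i, exchanging the two ends supplies the missing sign.
        step-at-split : ∀ pre x post → bySlope ≡ pre ++ x ∷ post → (X i ℚ.< X x) ⊎ (X x ℚ.< X i) →
                        step-at x ≡ ∑ pre (𝟙 ∘ below?) + ∑ post (𝟙 ∘ above?)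
        step-at-split pre x post eq either with above? x | either
        ... | yes x> | _ = splitCount (det i x) (p<q⇒0<q-p x>)
              (λ k≢i → det-slope (λ e → ℚ.<-irrefl (sym e) x>) (X≢ k≢i)) (det-iji i x) (det-ijj i x)
              (λ {k} k≢i k≢x → gp i x k (λ { refl → ℚ.<-irrefl refl x> }) (k≢i ∘ sym) (k≢x ∘ sym)) pre post eq
        ... | no x≯ | inj₁ x> = contradiction x> x≯
        ... | no _  | inj₂ x< = splitCount (det x i) (p<q⇒0<q-p x<)
              (λ {k} k≢i → trans (det-swap i x k) (trans (cong ℚ.-_ (det-slope (λ e → ℚ.<-irrefl e x<) (X≢ k≢i)))
                (solve 5 (λ xx xi c s t → :- ((xx :- xi) :* (c :* (s :- t))) := (xi :- xx) :* (c :* (s :- t))) refl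
                   (X x) (X i) (X k ℚ.- X i) (slope k) (slope x))))
              (det-ijj x i) (det-iji x i)
              (λ {k} k≢i k≢x → gp x i k (λ { refl → ℚ.<-irrefl refl x< }) (k≢x ∘ sym) (k≢i ∘ sym)) pre post eq
              where open +-*-Solver

        module _ (n≡ : n ≡ h + h + 2) where

          isHalving : Fin n → ℕ
          isHalving j = 𝟙 (leftCount i j ≟ h)

          step-at-halving : ∀ {j} → i ≢ j → 𝟙 (step-at j ≟ h) ≡ isHalving j
          step-at-halving {j} i≢j with above? j
          ... | yes _ = refl
          ... | no  _ = 𝟙-cong (leftCount j i ≟ h) (leftCount i j ≟ h)
                (leftCount-sym n≡ (i≢j ∘ sym)) (leftCount-sym n≡ i≢j)

          -- A half turn of the level line through i, as a walk over the points in order of slope.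
          -- Its height begins at the number of points above i and ends at the number below i; a
          -- step has lower end h exactly when it passes a halving line at i.
          rotate :
            𝟙 (h <? ∑ (allFin n) (𝟙 ∘ below?)) + ∑ (allFin n) (λ j → 𝟙 (above? j) * isHalving j) ≡
            𝟙 (h <? ∑ (allFin n) (𝟙 ∘ above?)) + ∑ (allFin n) (λ j → 𝟙 (below? j) * isHalving j)
          rotate = subst₂ _≡_
            (transport below? above? (ℚ.<-irrefl refl))
            (transport above? below? (ℚ.<-irrefl refl))
            (Walk.crossings above? below? h step-at bySlope step-at-split)
            where
            transport : ∀ {P Q : Fin n → Set} (P? : ∀ k → Dec (P k)) (Q? : ∀ k → Dec (Q k)) → ¬ Q i →
              𝟙 (h <? ∑ bySlope (𝟙 ∘ P?)) + ∑ bySlope (λ j → 𝟙 (Q? j) * 𝟙 (step-at j ≟ h)) ≡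
              𝟙 (h <? ∑ (allFin n) (𝟙 ∘ P?)) + ∑ (allFin n) (λ j → 𝟙 (Q? j) * isHalving j)
            transport P? Q? ¬Qi = cong₂ _+_
              (cong (λ s → 𝟙 (h <? s)) (∑-↭ (𝟙 ∘ P?) bySlope-↭))
              (trans (∑-↭ _ bySlope-↭) (∑-cong (allFin n) λ j → 𝟙-*-cong (Q? j) λ qj →
                step-at-halving (λ { refl → ¬Qi qj })))

  -- Double counting: each halving line between points of weight one crosses
  -- the median upwards at one of its ends and downwards at the other.
  module _ (gp : NoThreeCollinear) (X-inj : ∀ {i j : Fin n} → i ≢ j → X i ≢ X j) (h : ℕ) (n≡ : n ≡ h + h + 2)
           (α : Fin n → ℕ) (α-halving : ∀ {i j : Fin n} → i ≢ j → leftCount i j ≡ h → α i ≡ α j) where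

    open Rotation gp

    low high : Fin n → ℕ
    low  i = ∑ (allFin n) (λ k → 𝟙 (X k ℚ.<? X i))
    high i = ∑ (allFin n) (λ k → 𝟙 (X i ℚ.<? X k))

    balanced : ∑ (allFin n) (λ i → α i * 𝟙 (h <? low i)) ≡ ∑ (allFin n) (λ i → α i * 𝟙 (h <? high i))
    -- The weighted sum of `rotate` over all i; the totals of upward and downward crossings agree
    -- and cancel.
    balanced = +-cancelʳ-≡ up _ _ (begin
      ∑ (allFin n) (λ i → α i * 𝟙 (h <? low i)) + up
        ≡⟨ expand (λ i → 𝟙 (h <? low i)) (λ i j → 𝟙 (X i ℚ.<? X j) * H i j) ⟩
      ∑ (allFin n) (λ i → α i * (𝟙 (h <? low i) + ∑ (allFin n) (λ j → 𝟙 (X i ℚ.<? X j) * H i j)))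
        ≡⟨ ∑-cong (allFin n) (λ i → cong (α i *_) (rotate i X-inj h n≡)) ⟩
      ∑ (allFin n) (λ i → α i * (𝟙 (h <? high i) + ∑ (allFin n) (λ j → 𝟙 (X j ℚ.<? X i) * H i j)))
        ≡⟨ expand (λ i → 𝟙 (h <? high i)) (λ i j → 𝟙 (X j ℚ.<? X i) * H i j) ⟨
      ∑ (allFin n) (λ i → α i * 𝟙 (h <? high i)) + down
        ≡⟨ cong (∑ (allFin n) (λ i → α i * 𝟙 (h <? high i)) +_) (sym up≡down) ⟩
      ∑ (allFin n) (λ i → α i * 𝟙 (h <? high i)) + up ∎)
      where
      open ≡-Reasoning

      H : Fin n → Fin n → ℕ
      H i j = 𝟙 (leftCount i j ≟ h)

      up down : ℕ
      up   = ∑ (allFin n) (λ i → α i * ∑ (allFin n) (λ j → 𝟙 (X i ℚ.<? X j) * H i j))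
      down = ∑ (allFin n) (λ i → α i * ∑ (allFin n) (λ j → 𝟙 (X j ℚ.<? X i) * H i j))

      expand : ∀ (f : Fin n → ℕ) (g : Fin n → Fin n → ℕ) →
        ∑ (allFin n) (λ i → α i * f i) + ∑ (allFin n) (λ i → α i * ∑ (allFin n) (g i)) ≡
        ∑ (allFin n) (λ i → α i * (f i + ∑ (allFin n) (g i)))
      expand f g = trans (sym (∑-+ (allFin n) _ _))
        (∑-cong (allFin n) λ i → sym (*-distribˡ-+ (α i) (f i) _))

      H-sym : ∀ {i j} → i ≢ j → H i j ≡ H j i
      H-sym {i} {j} i≢j = 𝟙-cong (leftCount i j ≟ h) (leftCount j i ≟ h)
        (leftCount-sym n≡ i≢j) (leftCount-sym n≡ (i≢j ∘ sym))

      αH : ∀ {i j} → i ≢ j → α i * H i j ≡ α j * H j i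
      αH {i} {j} i≢j = begin
        α i * H i j  ≡⟨ *-comm (α i) (H i j) ⟩
        H i j * α i  ≡⟨ 𝟙-*-cong (leftCount i j ≟ h) (α-halving i≢j) ⟩
        H i j * α j  ≡⟨ cong (_* α j) (H-sym i≢j) ⟩
        H j i * α j  ≡⟨ *-comm (H j i) (α j) ⟩
        α j * H j i  ∎

      exchange : ∀ a b c → a * (b * c) ≡ b * (a * c)
      exchange = solve 3 (λ a b c → a :* (b :* c) := b :* (a :* c)) refl
        where open ℕ.+-*-Solver

      -- Exchanging the summations reads each halving line from its other end; its ends have equal
      -- weight, so `α i` may be replaced by `α j`.
      up≡down : up ≡ down
      up≡down = begin
        up
          ≡⟨ ∑-cong (allFin n) (λ i → ∑-* (allFin n) (α i) _) ⟨
        ∑ (allFin n) (λ i → ∑ (allFin n) (λ j → α i * (𝟙 (X i ℚ.<? X j) * H i j)))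
          ≡⟨ ∑-swap (allFin n) (allFin n) _ ⟩
        ∑ (allFin n) (λ j → ∑ (allFin n) (λ i → α i * (𝟙 (X i ℚ.<? X j) * H i j)))
          ≡⟨ ∑-cong (allFin n) (λ j → ∑-cong (allFin n) (λ i → begin
               α i * (𝟙 (X i ℚ.<? X j) * H i j)  ≡⟨ exchange (α i) (𝟙 (X i ℚ.<? X j)) (H i j) ⟩
               𝟙 (X i ℚ.<? X j) * (α i * H i j)  ≡⟨ 𝟙-*-cong (X i ℚ.<? X j) (λ lt → αH λ { refl → ℚ.<-irrefl refl lt }) ⟩
               𝟙 (X i ℚ.<? X j) * (α j * H j i)  ≡⟨ exchange (𝟙 (X i ℚ.<? X j)) (α j) (H j i) ⟩
               α j * (𝟙 (X i ℚ.<? X j) * H j i)  ∎)) ⟩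
        ∑ (allFin n) (λ j → ∑ (allFin n) (λ i → α j * (𝟙 (X i ℚ.<? X j) * H j i)))
          ≡⟨ ∑-cong (allFin n) (λ j → ∑-* (allFin n) (α j) _) ⟩
        down ∎

-- Perturbing a direction

Small : (ℚ → Set) → Set
Small Φ = ∃[ δ ] (0ℚ ℚ.< δ × (∀ η → 0ℚ ℚ.< η → η ℚ.≤ δ → Φ η))

small-∀ : ∀ {n} {Φ : Fin n → ℚ → Set} → (∀ i → Small (Φ i)) → Small (λ η → ∀ i → Φ i η)
small-∀ {zero}  _     = 1ℚ , ℚ.positive⁻¹ 1ℚ , λ _ _ _ ()
small-∀ {suc n} small =
  let (δ , 0<δ , φ) = small zero
      (δ′ , 0<δ′ , ψ) = small-∀ (small ∘ suc)
  in δ ℚ.⊓ δ′ , [ (λ e → subst (0ℚ ℚ.<_) (sym e) 0<δ) , (λ e → subst (0ℚ ℚ.<_) (sym e) 0<δ′) ]′ (ℚ.⊓-sel δ δ′)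
   , λ where
       η 0<η le zero    → φ η 0<η (ℚ.≤-trans le (ℚ.p⊓q≤p δ δ′))
       η 0<η le (suc i) → ψ η 0<η (ℚ.≤-trans le (ℚ.p⊓q≤q δ δ′)) i

dominate : ∀ e → ∃[ M ] (0ℚ ℚ.< M × 0ℚ ℚ.< M ℚ.+ e)
dominate e with 0ℚ ℚ.≤? e
... | yes 0≤e = 1ℚ , ℚ.positive⁻¹ 1ℚ , ℚ.+-mono-<-≤ (ℚ.positive⁻¹ 1ℚ) 0≤e
... | no  0≰e = 1ℚ ℚ.- e , ℚ.+-mono-< (ℚ.positive⁻¹ 1ℚ) (ℚ.neg-antimono-< (ℚ.≰⇒> 0≰e))
              , subst (0ℚ ℚ.<_) (solve 1 (λ e → con 1ℚ := con 1ℚ :- e :+ e) refl e) (ℚ.positive⁻¹ 1ℚ)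
  where open +-*-Solver

-- For c positive take M positive with M + e positive, and δ = c / M. Then c + η e = η (M + e) + (c
-- - M η), a positive number plus a nonnegative one.
small-lex : ∀ c e → 0ℚ ℚ.< c ⊎ (c ≡ 0ℚ × 0ℚ ℚ.< e) → Small (λ η → 0ℚ ℚ.< c ℚ.+ η ℚ.* e)
small-lex _ e (inj₂ (refl , 0<e)) = 1ℚ , ℚ.positive⁻¹ 1ℚ , λ η 0<η _ →
  subst (0ℚ ℚ.<_) (sym (ℚ.+-identityˡ (η ℚ.* e))) (0<p*q 0<η 0<e)
small-lex c e (inj₁ 0<c) = δ , 0<δ , λ η 0<η η≤δ →
  subst (0ℚ ℚ.<_) (solve 4 (λ c e M η → η :* (M :+ e) :+ (c :- M :* η) := c :+ η :* e) refl c e M η)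
    (ℚ.+-mono-<-≤ (0<p*q 0<η 0<M+e)
      (p≤q⇒0≤q-p (subst (M ℚ.* η ℚ.≤_) Mδ≡c (ℚ.*-monoˡ-≤-nonNeg M {{ℚ.nonNegative (ℚ.<⇒≤ 0<M)}} η≤δ))))
  where
  open +-*-Solver
  M = proj₁ (dominate e)
  0<M = proj₁ (proj₂ (dominate e))
  0<M+e = proj₂ (proj₂ (dominate e))
  δ = proj₁ (divide M c)
  Mδ≡c : M ℚ.* δ ≡ c
  Mδ≡c = proj₂ (divide M c) (0<⇒≢0 0<M)
  0<δ : 0ℚ ℚ.< δ
  0<δ = 0<p∧0<p*q⇒0<q 0<M (subst (0ℚ ℚ.<_) (sym Mδ≡c) 0<c)

-- A small multiple of G breaks the ties of F and reverses no strict inequality. There are finitely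
-- many pairs, so one η serves them all.
lexicographic : ∀ {n} (F G : Fin n → ℚ) → ∃[ η ] (∀ i j → F i ℚ.< F j ⊎ (F i ≡ F j × G i ℚ.< G j) →
                F i ℚ.+ η ℚ.* G i ℚ.< F j ℚ.+ η ℚ.* G j)
lexicographic F G =
  let (δ , 0<δ , φ) = small-∀ (λ i → small-∀ (pair i)) in δ , φ δ 0<δ ℚ.≤-refl
  where
  open +-*-Solver

  pair : ∀ i j → Small (λ η → F i ℚ.< F j ⊎ (F i ≡ F j × G i ℚ.< G j) → F i ℚ.+ η ℚ.* G i ℚ.< F j ℚ.+ η ℚ.* G j)
  pair i j with (F i ℚ.<? F j) ⊎-dec ((F i ℚ.≟ F j) ×-dec (G i ℚ.<? G j))
  ... | no ¬lt = 1ℚ , ℚ.positive⁻¹ 1ℚ , λ _ _ _ lt → contradiction lt ¬lt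
  ... | yes lt =
    let (δ , 0<δ , φ) = small-lex (F j ℚ.- F i) (G j ℚ.- G i) (Sum.map p<q⇒0<q-p
          (λ (e , l) → trans (cong (λ f → F j ℚ.- f) e) (ℚ.+-inverseʳ (F j)) , p<q⇒0<q-p l) lt)
    in δ , 0<δ , λ η 0<η η≤δ _ → 0<q-p⇒p<q (subst (0ℚ ℚ.<_)
         (solve 5 (λ fi fj gi gj η → fj :- fi :+ η :* (gj :- gi) := fj :+ η :* gj :- (fi :+ η :* gi)) refl
           (F i) (F j) (G i) (G j) η) (φ η 0<η η≤δ))

0<p*p : ∀ {p} → p ≢ 0ℚ → 0ℚ ℚ.< p ℚ.* p
0<p*p {p} p≢0 with ℚ.<-cmp 0ℚ p
... | tri< 0<p _ _ = 0<p*q 0<p 0<p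
... | tri≈ _ 0≡p _ = contradiction (sym 0≡p) p≢0
... | tri> _ _ p<0 = subst (0ℚ ℚ.<_) (solve 1 (λ p → :- p :* :- p := p :* p) refl p)
                       (0<p*q (ℚ.neg-antimono-< p<0) (ℚ.neg-antimono-< p<0))
  where open +-*-Solver

0≤p*p : ∀ p → 0ℚ ℚ.≤ p ℚ.* p
0≤p*p p with p ℚ.≟ 0ℚ
... | yes refl = ℚ.≤-refl
... | no  p≢0  = ℚ.<⇒≤ (0<p*p p≢0)

sum-of-squares : ∀ p q → (p ≡ 0ℚ × q ≡ 0ℚ) ⊎ 0ℚ ℚ.< p ℚ.* p ℚ.+ q ℚ.* q
sum-of-squares p q with p ℚ.≟ 0ℚ | q ℚ.≟ 0ℚ
... | yes p≡0 | yes q≡0 = inj₁ (p≡0 , q≡0)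
... | no  p≢0 | _       = inj₂ (ℚ.+-mono-<-≤ (0<p*p p≢0) (0≤p*p q))
... | yes _   | no  q≢0 = inj₂ (ℚ.+-mono-≤-< (0≤p*p p) (0<p*p q≢0))

-- The two halves for a direction close to ab

∑-at : ∀ {n} (f : Fin n → ℕ) i → ∑ (allFin n) (λ j → f j * 𝟙 (j Fin.≟ i)) ≡ f i
∑-at {n} f i = begin
  ∑ (allFin n) (λ j → f j * 𝟙 (j Fin.≟ i))
    ≡⟨ ∑-cong (allFin n) (λ j → trans (*-comm (f j) (𝟙 (j Fin.≟ i)))
         (trans (𝟙-*-cong (j Fin.≟ i) (cong f)) (*-comm (𝟙 (j Fin.≟ i)) (f i)))) ⟩
  ∑ (allFin n) (λ j → f i * 𝟙 (j Fin.≟ i))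
    ≡⟨ ∑-* (allFin n) (f i) _ ⟩
  f i * ∑ (allFin n) (λ j → 𝟙 (j Fin.≟ i))
    ≡⟨ cong (f i *_) (∑-δ i) ⟩
  f i * 1
    ≡⟨ *-identityʳ (f i) ⟩
  f i ∎
  where open ≡-Reasoning

𝟙-⊎ : ∀ {P Q : Set} (P? : Dec P) (Q? : Dec Q) → (P → ¬ Q) → 𝟙 (P? ⊎-dec Q?) ≡ 𝟙 P? + 𝟙 Q?
𝟙-⊎ (yes p) (yes q) disj = contradiction q (disj p)
𝟙-⊎ (yes _) (no _)  _    = refl
𝟙-⊎ (no _)  (yes _) _    = refl
𝟙-⊎ (no _)  (no _)  _    = refl

-- A point of U has all h + 1 points of D below it. A point of D has below it only other points of
-- D, at most h of them.
upper-half : ∀ {n h} {R : Fin n → Fin n → Set} (R? : ∀ i j → Dec (R i j)) → Asymmetric R →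
  {U D : Fin n → Set} (U? : ∀ i → Dec (U i)) (D? : ∀ i → Dec (D i)) →
  (∀ i → U i ⊎ D i) → (∀ {i j} → D i → U j → R i j) →
  ∑ (allFin n) (𝟙 ∘ D?) ≡ suc h →
  ∀ i → 𝟙 (h <? ∑ (allFin n) (λ k → 𝟙 (R? k i))) ≡ 𝟙 (U? i)
upper-half {n} {h} R? asym U? D? split D<U ∑D i with split i
... | inj₁ u = trans (𝟙-yes (h <? _) (subst (_≤ ∑ (allFin n) (λ k → 𝟙 (R? k i))) ∑D
                 (∑-mono (allFin n) λ k → 𝟙-mono (D? k) (R? k i) λ d → D<U d u)))
               (sym (𝟙-yes (U? i) u))
... | inj₂ d = trans (𝟙-no (h <? _) (≤⇒≯ (+-cancelʳ-≤ 1 _ _ (begin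
                   ∑ (allFin n) (λ k → 𝟙 (R? k i)) + 1
                     ≡⟨ cong (∑ (allFin n) (λ k → 𝟙 (R? k i)) +_) (∑-δ i) ⟨
                   ∑ (allFin n) (λ k → 𝟙 (R? k i)) + ∑ (allFin n) (λ k → 𝟙 (k Fin.≟ i))
                     ≡⟨ ∑-+ (allFin n) _ _ ⟨
                   ∑ (allFin n) (λ k → 𝟙 (R? k i) + 𝟙 (k Fin.≟ i))
                     ≤⟨ ∑-mono (allFin n) pointwise ⟩
                   ∑ (allFin n) (𝟙 ∘ D?)
                     ≡⟨ trans ∑D (+-comm 1 h) ⟩
                   h + 1 ∎))))
               (sym (𝟙-no (U? i) λ u → asym (D<U d u) (D<U d u)))
  where
  open ≤-Reasoning
  pointwise : ∀ k → 𝟙 (R? k i) + 𝟙 (k Fin.≟ i) ≤ 𝟙 (D? k)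
  pointwise k = subst (_≤ 𝟙 (D? k)) (𝟙-⊎ (R? k i) (k Fin.≟ i) λ { r refl → asym r r })
    (𝟙-mono (R? k i ⊎-dec (k Fin.≟ i)) (D? k) λ where
      (inj₁ r)    → [ (λ u → contradiction (D<U d u) (asym r)) , (λ d′ → d′) ]′ (split k)
      (inj₂ refl) → d)

-- Two coinciding points would be collinear with any third one; `distinct` takes its contradiction
-- from this index.
third-point : ∀ {n} {i j : Fin (3 + n)} → i ≢ j → ∃[ k ] (i ≢ k × j ≢ k)
third-point {i = i} {j} i≢j = Fin.punchIn i (Fin.punchIn (Fin.punchOut i≢j) zero)
  , (λ e → Fin.punchInᵢ≢i i _ (sym e))
  , λ e → Fin.punchInᵢ≢i (Fin.punchOut i≢j) zero (Fin.punchIn-injective i _ _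
      (trans (sym e) (sym (Fin.punchIn-punchOut i≢j))))

module _ {n h : ℕ} (x y : Fin n → ℚ) (gp : NoThreeCollinear x y) (n≡ : n ≡ h + h + 2)
         (other : ∀ {i j : Fin n} → i ≢ j → ∃[ k ] (i ≢ k × j ≢ k))
         (α : Fin n → ℕ) (α-halving : ∀ {i j : Fin n} → i ≢ j → leftCount x y i j ≡ h → α i ≡ α j)
         {a b : Fin n} (a≢b : a ≢ b) (a-b : leftCount x y a b ≡ h) where

  private
    dx dy : ℚ
    dx = x b ℚ.- x a
    dy = y b ℚ.- y a

    -- F is constant along ab; in X = F + η G the ties are broken by G.
    F G : Fin n → ℚ
    F i = dx ℚ.* y i ℚ.- dy ℚ.* x i
    G i = dx ℚ.* x i ℚ.+ dy ℚ.* y i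

    η : ℚ
    η = proj₁ (lexicographic F G)

    -- Collecting `F + η G` by coordinates gives `u x + w y`. With the perpendicular coordinate Y
    -- this is a rotation followed by a scaling, so orientations are preserved.
    u w : ℚ
    u = η ℚ.* dx ℚ.- dy
    w = dx ℚ.+ η ℚ.* dy

    X Y : Fin n → ℚ
    X i = u ℚ.* x i ℚ.+ w ℚ.* y i
    Y i = u ℚ.* y i ℚ.- w ℚ.* x i

    X-lex : ∀ i j → F i ℚ.< F j ⊎ (F i ≡ F j × G i ℚ.< G j) → X i ℚ.< X j
    X-lex i j lt = subst₂ ℚ._<_ (eq i) (eq j) (proj₂ (lexicographic F G) i j lt)
      where
      eq : ∀ i → F i ℚ.+ η ℚ.* G i ≡ X i
      eq i = solve 5 (λ dx dy η x y → dx :* y :- dy :* x :+ η :* (dx :* x :+ dy :* y) :=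
                                      (η :* dx :- dy) :* x :+ (dx :+ η :* dy) :* y) refl dx dy η (x i) (y i)
        where open +-*-Solver

    det≡0 : ∀ {i j k} → x j ℚ.- x i ≡ 0ℚ → y j ℚ.- y i ≡ 0ℚ → det x y i j k ≡ 0ℚ
    det≡0 {i} {j} {k} ex ey = trans (cong₂ (λ p q → p ℚ.* (y k ℚ.- y i) ℚ.- q ℚ.* (x k ℚ.- x i)) ex ey)
      (solve 2 (λ p q → con 0ℚ :* p :- con 0ℚ :* q := con 0ℚ) refl (y k ℚ.- y i) (x k ℚ.- x i))
      where open +-*-Solver

    distinct : ∀ {i j} → i ≢ j → ¬ (x j ℚ.- x i ≡ 0ℚ × y j ℚ.- y i ≡ 0ℚ)
    distinct i≢j (ex , ey) = let (k , i≢k , j≢k) = other i≢j in gp _ _ k i≢j i≢k j≢k (det≡0 ex ey)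

    0<dx²+dy² : 0ℚ ℚ.< dx ℚ.* dx ℚ.+ dy ℚ.* dy
    0<dx²+dy² = [ (λ z → contradiction z (distinct a≢b)) , (λ lt → lt) ]′ (sum-of-squares dx dy)

    -- F and G are orthogonal coordinates up to scale: their differences recover those of x and y
    -- multiplied by dx² + dy², which is positive.
    lex-total : ∀ {i j} → i ≢ j → ¬ (F i ≡ F j × G i ≡ G j)
    lex-total {i} {j} i≢j (ef , eg) = distinct i≢j
      ( p*q≡0∧p≢0⇒q≡0 (trans
          (solve 6 (λ dx dy xi yi xj yj → (dx :* dx :+ dy :* dy) :* (xj :- xi) :=
             dx :* ((dx :* xj :+ dy :* yj) :- (dx :* xi :+ dy :* yi)) :- dy :* ((dx :* yj :- dy :* xj) :- (dx :* yi :- dy :* xi)))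
             refl dx dy (x i) (y i) (x j) (y j))
          (trans (cong₂ (λ f g → dx ℚ.* (G j ℚ.- g) ℚ.- dy ℚ.* (F j ℚ.- f)) ef eg)
            (solve 4 (λ dx dy f g → dx :* (g :- g) :- dy :* (f :- f) := con 0ℚ) refl dx dy (F j) (G j))))
          (0<⇒≢0 0<dx²+dy²)
      , p*q≡0∧p≢0⇒q≡0 (trans
          (solve 6 (λ dx dy xi yi xj yj → (dx :* dx :+ dy :* dy) :* (yj :- yi) :=
             dy :* ((dx :* xj :+ dy :* yj) :- (dx :* xi :+ dy :* yi)) :+ dx :* ((dx :* yj :- dy :* xj) :- (dx :* yi :- dy :* xi)))
             refl dx dy (x i) (y i) (x j) (y j))
          (trans (cong₂ (λ f g → dy ℚ.* (G j ℚ.- g) ℚ.+ dx ℚ.* (F j ℚ.- f)) ef eg)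
            (solve 4 (λ dx dy f g → dy :* (g :- g) :+ dx :* (f :- f) := con 0ℚ) refl dx dy (F j) (G j))))
          (0<⇒≢0 0<dx²+dy²) )
      where open +-*-Solver

    X-inj : ∀ {i j} → i ≢ j → X i ≢ X j
    X-inj {i} {j} i≢j Xi≡Xj with ℚ.<-cmp (F i) (F j)
    ... | tri< lt _ _ = ℚ.<-irrefl Xi≡Xj (X-lex i j (inj₁ lt))
    ... | tri> _ _ gt = ℚ.<-irrefl (sym Xi≡Xj) (X-lex j i (inj₁ gt))
    ... | tri≈ _ ef _ with ℚ.<-cmp (G i) (G j)
    ...   | tri< lt _ _ = ℚ.<-irrefl Xi≡Xj (X-lex i j (inj₂ (ef , lt)))
    ...   | tri> _ _ gt = ℚ.<-irrefl (sym Xi≡Xj) (X-lex j i (inj₂ (sym ef , gt)))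
    ...   | tri≈ _ eg _ = lex-total i≢j (ef , eg)

    -- Were u and w both 0, X would vanish everywhere and could not separate a from b.
    0<u²+w² : 0ℚ ℚ.< u ℚ.* u ℚ.+ w ℚ.* w
    0<u²+w² = [ (λ (eu , ew) → contradiction (trans (zero-X eu ew a) (sym (zero-X eu ew b))) (X-inj a≢b))
              , (λ lt → lt) ]′ (sum-of-squares u w)
      where
      zero-X : u ≡ 0ℚ → w ≡ 0ℚ → ∀ i → X i ≡ 0ℚ
      zero-X eu ew i = trans (cong₂ (λ u w → u ℚ.* x i ℚ.+ w ℚ.* y i) eu ew)
        (solve 2 (λ x y → con 0ℚ :* x :+ con 0ℚ :* y := con 0ℚ) refl (x i) (y i))
        where open +-*-Solver

    det-rotated : ∀ i j k → det X Y i j k ≡ (u ℚ.* u ℚ.+ w ℚ.* w) ℚ.* det x y i j k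
    det-rotated i j k = solve 8 (λ u w xi yi xj yj xk yk →
      ((u :* xj :+ w :* yj) :- (u :* xi :+ w :* yi)) :* ((u :* yk :- w :* xk) :- (u :* yi :- w :* xi)) :-
      ((u :* yj :- w :* xj) :- (u :* yi :- w :* xi)) :* ((u :* xk :+ w :* yk) :- (u :* xi :+ w :* yi)) :=
      (u :* u :+ w :* w) :* ((xj :- xi) :* (yk :- yi) :- (yj :- yi) :* (xk :- xi)))
      refl u w (x i) (y i) (x j) (y j) (x k) (y k)
      where open +-*-Solver

    gp-rotated : NoThreeCollinear X Y
    gp-rotated i j k i≢j i≢k j≢k eq = gp i j k i≢j i≢k j≢k
      (p*q≡0∧p≢0⇒q≡0 (trans (sym (det-rotated i j k)) eq) (0<⇒≢0 0<u²+w²))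

    leftCount-rotated : ∀ i j → leftCount X Y i j ≡ leftCount x y i j
    leftCount-rotated i j = ∑-cong (allFin n) λ k → 𝟙-cong (0ℚ ℚ.<? det X Y i j k) (0ℚ ℚ.<? det x y i j k)
      (λ lt → 0<p∧0<p*q⇒0<q 0<u²+w² (subst (0ℚ ℚ.<_) (det-rotated i j k) lt))
      (λ lt → subst (0ℚ ℚ.<_) (sym (det-rotated i j k)) (0<p*q 0<u²+w² lt))

    left? : ∀ i → Dec (0ℚ ℚ.< det x y a b i)
    left? i = 0ℚ ℚ.<? det x y a b i

    right? : ∀ i → Dec (0ℚ ℚ.< det x y b a i)
    right? i = 0ℚ ℚ.<? det x y b a i

    -- The determinant equals both F i - F a and F i - F b.
    left-F : ∀ {i} → 0ℚ ℚ.< det x y a b i → F a ℚ.< F i × F b ℚ.< F i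
    left-F {i} lt = 0<q-p⇒p<q (subst (0ℚ ℚ.<_) (solve 6 (λ xa ya xb yb xi yi →
         (xb :- xa) :* (yi :- ya) :- (yb :- ya) :* (xi :- xa) :=
         ((xb :- xa) :* yi :- (yb :- ya) :* xi) :- ((xb :- xa) :* ya :- (yb :- ya) :* xa))
         refl (x a) (y a) (x b) (y b) (x i) (y i)) lt)
      , 0<q-p⇒p<q (subst (0ℚ ℚ.<_) (solve 6 (λ xa ya xb yb xi yi →
         (xb :- xa) :* (yi :- ya) :- (yb :- ya) :* (xi :- xa) :=
         ((xb :- xa) :* yi :- (yb :- ya) :* xi) :- ((xb :- xa) :* yb :- (yb :- ya) :* xb))
         refl (x a) (y a) (x b) (y b) (x i) (y i)) lt)
      where open +-*-Solver

    right-F : ∀ {i} → 0ℚ ℚ.< det x y b a i → F i ℚ.< F a × F i ℚ.< F b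
    right-F {i} lt = 0<q-p⇒p<q (subst (0ℚ ℚ.<_) (solve 6 (λ xa ya xb yb xi yi →
         (xa :- xb) :* (yi :- yb) :- (ya :- yb) :* (xi :- xb) :=
         ((xb :- xa) :* ya :- (yb :- ya) :* xa) :- ((xb :- xa) :* yi :- (yb :- ya) :* xi))
         refl (x a) (y a) (x b) (y b) (x i) (y i)) lt)
      , 0<q-p⇒p<q (subst (0ℚ ℚ.<_) (solve 6 (λ xa ya xb yb xi yi →
         (xa :- xb) :* (yi :- yb) :- (ya :- yb) :* (xi :- xb) :=
         ((xb :- xa) :* yb :- (yb :- ya) :* xb) :- ((xb :- xa) :* yi :- (yb :- ya) :* xi))
         refl (x a) (y a) (x b) (y b) (x i) (y i)) lt)
      where open +-*-Solver

    -- The indices `lo` and `hi` are a and b in the order of X, so that both orders are treated at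
    -- once. The right side joined by `lo` and the left side joined by `hi` are the lower and upper
    -- halves, of h + 1 points each.
    module Split (lo hi : Fin n) (lo<hi : X lo ℚ.< X hi)
                 (cover : ∀ {i : Fin n} → i ≡ a ⊎ i ≡ b → i ≡ lo ⊎ i ≡ hi)
                 (lo∈ : lo ≡ a ⊎ lo ≡ b) (hi∈ : hi ≡ a ⊎ hi ≡ b) where

      on-line : ∀ {i} → i ≡ a ⊎ i ≡ b → det x y a b i ≡ 0ℚ × det x y b a i ≡ 0ℚ
      on-line (inj₁ refl) = det-iji x y a b , det-ijj x y b a
      on-line (inj₂ refl) = det-ijj x y a b , det-iji x y b a

      up? : ∀ i → Dec (0ℚ ℚ.< det x y a b i ⊎ i ≡ hi)
      up? i = left? i ⊎-dec (i Fin.≟ hi)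

      down? : ∀ i → Dec (0ℚ ℚ.< det x y b a i ⊎ i ≡ lo)
      down? i = right? i ⊎-dec (i Fin.≟ lo)

      𝟙-up : ∀ i → 𝟙 (up? i) ≡ 𝟙 (left? i) + 𝟙 (i Fin.≟ hi)
      𝟙-up i = 𝟙-⊎ (left? i) (i Fin.≟ hi) λ { lt refl → 0<⇒≢0 lt (proj₁ (on-line hi∈)) }

      𝟙-down : ∀ i → 𝟙 (down? i) ≡ 𝟙 (right? i) + 𝟙 (i Fin.≟ lo)
      𝟙-down i = 𝟙-⊎ (right? i) (i Fin.≟ lo) λ { lt refl → 0<⇒≢0 lt (proj₂ (on-line lo∈)) }

      total : ∀ i → (0ℚ ℚ.< det x y a b i ⊎ i ≡ hi) ⊎ (0ℚ ℚ.< det x y b a i ⊎ i ≡ lo)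
      total i with i Fin.≟ a | i Fin.≟ b | ℚ.<-cmp 0ℚ (det x y a b i)
      ... | yes i≡a | _       | _ = [ inj₂ ∘ inj₂ , inj₁ ∘ inj₂ ]′ (cover (inj₁ i≡a))
      ... | no _    | yes i≡b | _ = [ inj₂ ∘ inj₂ , inj₁ ∘ inj₂ ]′ (cover (inj₂ i≡b))
      ... | no _    | no _    | tri< lt _ _ = inj₁ (inj₁ lt)
      ... | no i≢a  | no i≢b  | tri≈ _ eq _ = contradiction (sym eq) (gp a b i a≢b (i≢a ∘ sym) (i≢b ∘ sym))
      ... | no _    | no _    | tri> _ _ gt = inj₂ (inj₁ (subst (0ℚ ℚ.<_) (sym (det-swap x y a b i)) (ℚ.neg-antimono-< gt)))

      line<left : ∀ {i j} → i ≡ a ⊎ i ≡ b → 0ℚ ℚ.< det x y a b j → X i ℚ.< X j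
      line<left (inj₁ refl) lt = X-lex _ _ (inj₁ (proj₁ (left-F lt)))
      line<left (inj₂ refl) lt = X-lex _ _ (inj₁ (proj₂ (left-F lt)))

      right<line : ∀ {i j} → i ≡ a ⊎ i ≡ b → 0ℚ ℚ.< det x y b a j → X j ℚ.< X i
      right<line (inj₁ refl) lt = X-lex _ _ (inj₁ (proj₁ (right-F lt)))
      right<line (inj₂ refl) lt = X-lex _ _ (inj₁ (proj₂ (right-F lt)))

      down<up : ∀ {i j} → 0ℚ ℚ.< det x y b a i ⊎ i ≡ lo → 0ℚ ℚ.< det x y a b j ⊎ j ≡ hi → X i ℚ.< X j
      down<up (inj₁ r)    (inj₁ l)    = ℚ.<-trans (right<line lo∈ r) (line<left lo∈ l)
      down<up (inj₁ r)    (inj₂ refl) = right<line hi∈ r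
      down<up (inj₂ refl) (inj₁ l)    = line<left lo∈ l
      down<up (inj₂ refl) (inj₂ refl) = lo<hi

      b-a : leftCount x y b a ≡ h
      b-a = Rotation.leftCount-sym x y gp n≡ a≢b a-b

      ∑-up : ∑ (allFin n) (𝟙 ∘ up?) ≡ suc h
      ∑-up = trans (∑-cong (allFin n) 𝟙-up) (trans (∑-+ (allFin n) _ _)
        (trans (cong₂ _+_ a-b (∑-δ hi)) (+-comm h 1)))

      ∑-down : ∑ (allFin n) (𝟙 ∘ down?) ≡ suc h
      ∑-down = trans (∑-cong (allFin n) 𝟙-down) (trans (∑-+ (allFin n) _ _)
        (trans (cong₂ _+_ b-a (∑-δ lo)) (+-comm h 1)))

      weigh : ∀ (f : Fin n → ℕ) i → ∑ (allFin n) (λ j → α j * (f j + 𝟙 (j Fin.≟ i))) ≡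
                                    ∑ (allFin n) (λ j → α j * f j) + α i
      weigh f i = trans (∑-cong (allFin n) λ j → *-distribˡ-+ (α j) (f j) _)
        (trans (∑-+ (allFin n) _ _) (cong (∑ (allFin n) (λ j → α j * f j) +_) (∑-at α i)))

      αa≡αb : α a ≡ α b
      αa≡αb = α-halving a≢b a-b

      α-line : ∀ {i} → i ≡ a ⊎ i ≡ b → α i ≡ α a
      α-line (inj₁ refl) = refl
      α-line (inj₂ refl) = sym αa≡αb

      conclusion : ∑ (allFin n) (λ i → α i * 𝟙 (left? i)) ≡ ∑ (allFin n) (λ i → α i * 𝟙 (right? i))
      -- Both `lo` and `hi` have weight `α a`; adding it completes the open half-planes to the two
      -- halves.
      conclusion = +-cancelʳ-≡ (α a) _ _ (begin
        ∑ (allFin n) (λ i → α i * 𝟙 (left? i)) + α a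
          ≡⟨ cong (∑ (allFin n) (λ i → α i * 𝟙 (left? i)) +_) (α-line hi∈) ⟨
        ∑ (allFin n) (λ i → α i * 𝟙 (left? i)) + α hi
          ≡⟨ weigh (𝟙 ∘ left?) hi ⟨
        ∑ (allFin n) (λ i → α i * (𝟙 (left? i) + 𝟙 (i Fin.≟ hi)))
          -- More than h points are lower exactly for the members of the upper half. After
          -- `balanced`, the same lemma is applied to the reversed order.
          ≡⟨ ∑-cong (allFin n) (λ i → cong (α i *_) (trans
               (upper-half (λ j k → X j ℚ.<? X k) ℚ.<-asym up? down? total down<up ∑-down i) (𝟙-up i))) ⟨
        ∑ (allFin n) (λ i → α i * 𝟙 (h <? ∑ (allFin n) (λ k → 𝟙 (X k ℚ.<? X i))))
          ≡⟨ balanced X Y gp-rotated X-inj h n≡ α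
               (λ {i} {j} i≢j e → α-halving i≢j (trans (sym (leftCount-rotated i j)) e)) ⟩
        ∑ (allFin n) (λ i → α i * 𝟙 (h <? ∑ (allFin n) (λ k → 𝟙 (X i ℚ.<? X k))))
          ≡⟨ ∑-cong (allFin n) (λ i → cong (α i *_) (trans
               (upper-half (λ j k → X k ℚ.<? X j) ℚ.<-asym down? up? (Sum.swap ∘ total) (flip down<up) ∑-up i) (𝟙-down i))) ⟩
        ∑ (allFin n) (λ i → α i * (𝟙 (right? i) + 𝟙 (i Fin.≟ lo)))
          ≡⟨ weigh (𝟙 ∘ right?) lo ⟩
        ∑ (allFin n) (λ i → α i * 𝟙 (right? i)) + α lo
          ≡⟨ cong (∑ (allFin n) (λ i → α i * 𝟙 (right? i)) +_) (α-line lo∈) ⟩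
        ∑ (allFin n) (λ i → α i * 𝟙 (right? i)) + α a ∎)
        where open ≡-Reasoning

  halved : ∑ (allFin n) (λ i → α i * 𝟙 (0ℚ ℚ.<? det x y a b i)) ≡ ∑ (allFin n) (λ i → α i * 𝟙 (0ℚ ℚ.<? det x y b a i))
  halved with ℚ.<-cmp (X a) (X b)
  ... | tri< lt _ _ = Split.conclusion a b lt (λ e → e) (inj₁ refl) (inj₂ refl)
  ... | tri≈ _ eq _ = contradiction eq (X-inj a≢b)
  ... | tri> _ _ gt = Split.conclusion b a gt Sum.swap (inj₂ refl) (inj₁ refl)

-- Counting with subsets

𝟙-× : ∀ {P Q : Set} (P? : Dec P) (Q? : Dec Q) → 𝟙 (P? ×-dec Q?) ≡ 𝟙 P? * 𝟙 Q?
𝟙-× (yes _) (yes _) = refl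
𝟙-× (yes _) (no _)  = refl
𝟙-× (no _)  Q?      = refl

∣∣-∑ : ∀ {n} (S : Subset n) → ∣ S ∣ ≡ ∑ (allFin n) (λ i → 𝟙 (i ∈? S))
∣∣-∑ []                = refl
∣∣-∑ {suc n} (inside  ∷ S) = trans (cong suc (∣∣-∑ S)) (sym (∑-suc (λ i → 𝟙 (i ∈? (inside ∷ S)))))
∣∣-∑ {suc n} (outside ∷ S) = trans (∣∣-∑ S) (sym (∑-suc (λ i → 𝟙 (i ∈? (outside ∷ S)))))

∣∣-count : ∀ {n} (S : Subset n) {Q : Fin n → Set} (Q? : ∀ i → Dec (Q i)) → (∀ i → i ∈ S ⇔ Q i) →
           ∣ S ∣ ≡ ∑ (allFin n) (λ i → 𝟙 (Q? i))
∣∣-count {n} S Q? S⇔Q = trans (∣∣-∑ S) (∑-cong (allFin n) λ i → 𝟙-cong (i ∈? S) (Q? i) (to (S⇔Q i)) (from (S⇔Q i)))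

∩⇔ : ∀ {n} (A R : Subset n) {Q : Fin n → Set} → (∀ i → i ∈ R ⇔ Q i) → ∀ i → i ∈ A ∩ R ⇔ (i ∈ A × Q i)
∩⇔ A R R⇔ i = mk⇔
  (λ i∈ → let (i∈A , i∈R) = x∈p∩q⁻ A R i∈ in i∈A , to (R⇔ i) i∈R)
  (λ (i∈A , q) → x∈p∩q⁺ (i∈A , from (R⇔ i) q))

exactlyMany : ∀ {n k} {Q R : Fin n → Set} (Q? : ∀ i → Dec (Q i)) → (∀ i → Q i ⇔ R i) →
              ∑ (allFin n) (λ i → 𝟙 (Q? i)) ≡ k → ExactlyMany k R
exactlyMany {n} {Q = Q} Q? Q⇔R ∑Q = S , trans (∣∣-count S Q? S⇔Q) ∑Q ,
  λ i → Q⇔R i ⇔-∘ S⇔Q i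
  where
  S : Subset n
  S = tabulate (does ∘ Q?)

  S⇔Q : ∀ i → i ∈ S ⇔ Q i
  S⇔Q i = mk⇔
    (λ i∈S → does⇒ (Q? i) (trans (sym (lookup∘tabulate (does ∘ Q?) i)) ([]=⇒lookup i∈S)))
    (λ q → lookup⇒[]= i S (trans (lookup∘tabulate (does ∘ Q?) i) (dec-true (Q? i) q)))
    where
    does⇒ : ∀ {P : Set} (P? : Dec P) → does P? ≡ inside → P
    does⇒ (yes p) _ = p

-- Rational approximation of real points

p≤∣p∣ : ∀ p → p ℚ.≤ ℚ.∣ p ∣
p≤∣p∣ p with 0ℚ ℚ.≤? p
... | yes 0≤p = ℚ.≤-reflexive (sym (ℚ.0≤p⇒∣p∣≡p 0≤p))
... | no  0≰p = ℚ.≤-trans (ℚ.<⇒≤ (ℚ.≰⇒> 0≰p)) (ℚ.0≤∣p∣ p)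

-p≤∣p∣ : ∀ p → ℚ.- p ℚ.≤ ℚ.∣ p ∣
-p≤∣p∣ p = subst (ℚ.- p ℚ.≤_) (ℚ.∣-p∣≡∣p∣ p) (p≤∣p∣ (ℚ.- p))

∣p∣≤ : ∀ {p e} → p ℚ.≤ e → ℚ.- p ℚ.≤ e → ℚ.∣ p ∣ ℚ.≤ e
∣p∣≤ {p} {e} p≤e -p≤e = [ (λ eq → subst (ℚ._≤ e) (sym eq) p≤e) , (λ eq → subst (ℚ._≤ e) (sym eq) -p≤e) ]′
                          (ℚ.∣p∣≡p∨∣p∣≡-p p)

-- Past N the terms differ from x N by less than e / 2. If x N or its negative exceeded e / 2, the
-- excess would witness one of the two excluded inequalities.
¬<∧¬>⇒≈0 : ∀ r → ¬ (0ℝ ℝ.< r) → ¬ (r ℝ.< 0ℝ) → r ≈ 0ℝ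
¬<∧¬>⇒≈0 r ≮ ≯ e 0<e with cauchy r (½ ℚ.* e) (0<p*q (ℚ.positive⁻¹ ½) 0<e)
... | N , close = N , λ n N≤n → begin-strict
    ℚ.∣ x n ℚ.- 0ℚ ∣                        ≡⟨ cong ℚ.∣_∣ (solve 2 (λ a b → a :- con 0ℚ := b :- (b :- a)) refl (x n) (x N)) ⟩
    ℚ.∣ x N ℚ.- (x N ℚ.- x n) ∣             ≤⟨ ℚ.∣p-q∣≤∣p∣+∣q∣ (x N) (x N ℚ.- x n) ⟩
    ℚ.∣ x N ∣ ℚ.+ ℚ.∣ x N ℚ.- x n ∣         <⟨ ℚ.+-mono-≤-< (∣p∣≤ (ℚ.≮⇒≥ x≯) (ℚ.≮⇒≥ -x≯)) (close N n ≤-refl N≤n) ⟩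
    ½ ℚ.* e ℚ.+ ½ ℚ.* e                     ≡⟨ solve 1 (λ e → con ½ :* e :+ con ½ :* e := e) refl e ⟩
    e                                       ∎
  where
  open +-*-Solver
  open ℚ.≤-Reasoning

  x : ℕ → ℚ
  x = seq r

  x≯ : ¬ (½ ℚ.* e ℚ.< x N)
  x≯ lt = ≮ (x N ℚ.- ½ ℚ.* e , p<q⇒0<q-p lt , N , λ n N≤n → 0<q-p⇒p<q (subst (0ℚ ℚ.<_)
    (solve 3 (λ h a b → h :- (a :- b) := b :- (con 0ℚ :+ (a :- h))) refl (½ ℚ.* e) (x N) (x n))
    (p<q⇒0<q-p (ℚ.≤-<-trans (p≤∣p∣ (x N ℚ.- x n)) (close N n ≤-refl N≤n)))))

  -x≯ : ¬ (½ ℚ.* e ℚ.< ℚ.- x N)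
  -x≯ lt = ≯ (ℚ.- x N ℚ.- ½ ℚ.* e , p<q⇒0<q-p lt , N , λ n N≤n → 0<q-p⇒p<q (subst (0ℚ ℚ.<_)
    (solve 3 (λ h a b → h :- (:- (a :- b)) := con 0ℚ :- (b :+ (:- a :- h))) refl (½ ℚ.* e) (x N) (x n))
    (p<q⇒0<q-p (ℚ.≤-<-trans (-p≤∣p∣ (x N ℚ.- x n)) (close N n ≤-refl N≤n)))))

SignAt : ℝ → ℕ → Set
SignAt r m = (0ℚ ℚ.< seq r m ⇔ 0ℝ ℝ.< r) × (seq r m ℚ.< 0ℚ ⇔ r ℝ.< 0ℝ)

Eventually : (ℕ → Set) → Set
Eventually Φ = ∃[ N ] (∀ m → N ≤ m → Φ m)

eventually-∀ : ∀ {n} {Φ : Fin n → ℕ → Set} → (∀ i → Eventually (Φ i)) → Eventually (λ m → ∀ i → Φ i m)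
eventually-∀ {zero}  ev = 0 , λ _ _ ()
eventually-∀ {suc n} ev =
  let (M , φ) = ev zero
      (N , ψ) = eventually-∀ (ev ∘ suc)
  in M ⊔ N , λ where
    m le zero    → φ m (m⊔n≤o⇒m≤o M N le)
    m le (suc i) → ψ m (m⊔n≤o⇒n≤o M N le) i

0<⇒eventually : ∀ r → 0ℝ ℝ.< r → Eventually (λ m → 0ℚ ℚ.< seq r m)
0<⇒eventually r (e , 0<e , N , φ) = N , λ m le →
  ℚ.<-trans 0<e (subst (ℚ._< seq r m) (ℚ.+-identityˡ e) (φ m le))

<0⇒eventually : ∀ r → r ℝ.< 0ℝ → Eventually (λ m → seq r m ℚ.< 0ℚ)
<0⇒eventually r (e , 0<e , N , φ) = N , λ m le →
  ℚ.<-trans (subst (ℚ._< seq r m ℚ.+ e) (ℚ.+-identityʳ (seq r m)) (ℚ.+-monoʳ-< (seq r m) 0<e)) (φ m le)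

eventually-clash : ∀ {Φ Ψ : ℕ → Set} → Eventually Φ → Eventually Ψ → (∀ m → Φ m → ¬ Ψ m) → ∀ {A : Set} → A
eventually-clash (M , φ) (N , ψ) clash = contradiction (ψ (M ⊔ N) (m≤n⊔m M N)) (clash _ (φ (M ⊔ N) (m≤m⊔n M N)))

signAt-0< : ∀ r → 0ℝ ℝ.< r → Eventually (SignAt r)
signAt-0< r 0<r = let (N , φ) = 0<⇒eventually r 0<r in N , λ m le →
  mk⇔ (λ _ → 0<r) (λ _ → φ m le) ,
  mk⇔ (λ lt → contradiction lt (ℚ.<-asym (φ m le)))
      (λ r<0 → eventually-clash (N , φ) (<0⇒eventually r r<0) (λ _ → ℚ.<-asym))

signAt-<0 : ∀ r → r ℝ.< 0ℝ → Eventually (SignAt r)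
signAt-<0 r r<0 = let (N , φ) = <0⇒eventually r r<0 in N , λ m le →
  mk⇔ (λ lt → contradiction lt (ℚ.<-asym (φ m le)))
      (λ 0<r → eventually-clash (N , φ) (0<⇒eventually r 0<r) (λ _ → ℚ.<-asym)) ,
  mk⇔ (λ _ → r<0) (λ _ → φ m le)

signAt-0 : ∀ r → (∀ m → seq r m ≡ 0ℚ) → Eventually (SignAt r)
signAt-0 r r≡0 = 0 , λ m _ →
  mk⇔ (λ lt → contradiction (sym (r≡0 m)) (ℚ.<⇒≢ lt))
      (λ 0<r → let (N , φ) = 0<⇒eventually r 0<r in contradiction (sym (r≡0 N)) (ℚ.<⇒≢ (φ N ≤-refl))) ,
  mk⇔ (λ lt → contradiction (r≡0 m) (ℚ.<⇒≢ lt))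
      (λ r<0 → let (N , φ) = <0⇒eventually r r<0 in contradiction (r≡0 N) (ℚ.<⇒≢ (φ N ≤-refl)))

-- Either strict sign of r is eventually that of its terms. If this never happened, neither sign
-- could hold and r would be zero.
¬¬-signAt : ∀ r → ¬ (r ≈ 0ℝ) → DoubleNegation (Eventually (SignAt r))
¬¬-signAt r r≉0 ¬ev = r≉0 (¬<∧¬>⇒≈0 r (¬ev ∘ signAt-0< r) (¬ev ∘ signAt-<0 r))

-- A double-negation shift, obtained by sequencing finitely many statements in the ¬¬ monad.
¬¬-∀ : ∀ {n} {Φ : Fin n → Set} → (∀ i → DoubleNegation (Φ i)) → DoubleNegation (∀ i → Φ i)
¬¬-∀ = Fin.sequence (RawMonad.rawApplicative ¬¬-Monad)

module _ {n : ℕ} (P : Fin n → Point) (gp : GeneralPosition P) where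

  xs ys : ℕ → Fin n → ℚ
  xs m i = seq (proj₁ (P i)) m
  ys m i = seq (proj₂ (P i)) m

  Agree : ℕ → Set
  Agree m = ∀ i j k → SignAt (cross (P i) (P j) (P k)) m

  -- Each triple has an index past which its sign is right; m is the maximum of these.
  ¬¬-agree : DoubleNegation (∃[ m ] Agree m)
  ¬¬-agree = ¬¬-map
    (λ ev → let (N , φ) = eventually-∀ λ i → eventually-∀ λ j → eventually-∀ (ev i j) in N , φ N ≤-refl)
    (¬¬-∀ λ i → ¬¬-∀ λ j → ¬¬-∀ λ k → triple i j k)
    where
    open +-*-Solver

    triple : ∀ i j k → DoubleNegation (Eventually (SignAt (cross (P i) (P j) (P k))))
    -- If two indices coincide, every term of the cross product is 0; general position handles the
    -- remaining triples.
    triple i j k with i Fin.≟ j | i Fin.≟ k | j Fin.≟ k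
    ... | no i≢j   | no i≢k   | no j≢k   = ¬¬-signAt (cross (P i) (P j) (P k)) (gp i j k i≢j i≢k j≢k)
    ... | yes refl | _        | _        = λ ¬ev → ¬ev (signAt-0 (cross (P i) (P j) (P k)) λ m →
      solve 4 (λ xi yi xk yk → (xi :- xi) :* (yk :- yi) :- (yi :- yi) :* (xk :- xi) := con 0ℚ) refl
        (xs m i) (ys m i) (xs m k) (ys m k))
    ... | _        | yes refl | _        = λ ¬ev → ¬ev (signAt-0 (cross (P i) (P j) (P k)) λ m → det-iji (xs m) (ys m) i j)
    ... | _        | _        | yes refl = λ ¬ev → ¬ev (signAt-0 (cross (P i) (P j) (P k)) λ m → det-ijj (xs m) (ys m) i j)

  module Approximation {m} (agree : Agree m) where

    x y : Fin n → ℚ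
    x = xs m
    y = ys m

    -- A zero determinant at m would rule out both strict signs of the real cross product, which
    -- would then be zero.
    noThreeCollinear : NoThreeCollinear x y
    noThreeCollinear i j k i≢j i≢k j≢k eq = gp i j k i≢j i≢k j≢k
      (¬<∧¬>⇒≈0 (cross (P i) (P j) (P k))
        (λ lt → 0<⇒≢0 (from (proj₁ (agree i j k)) lt) eq)
        (λ lt → ℚ.<⇒≢ (from (proj₂ (agree i j k)) lt) eq))

    left⇔ : ∀ i j k → 0ℚ ℚ.< det x y i j k ⇔ LeftOf (P i) (P j) (P k)
    left⇔ i j k = proj₁ (agree i j k)

    right⇔ : ∀ i j k → 0ℚ ℚ.< det x y j i k ⇔ RightOf (P i) (P j) (P k)
    right⇔ i j k = mk⇔
      (λ lt → to (proj₂ (agree i j k)) (0<-⇒<0 (subst (0ℚ ℚ.<_) (det-swap x y i j k) lt)))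
      (λ r → subst (0ℚ ℚ.<_) (sym (det-swap x y i j k)) (ℚ.neg-antimono-< (from (proj₂ (agree i j k)) r)))

-- The theorem for real points

even-half : ∀ n → 2 ∣ 2 + n → 2 + n ≡ n / 2 + n / 2 + 2
even-half n (divides (suc q) eq) = begin
  2 + n              ≡⟨ +-comm 2 n ⟩
  n + 2              ≡⟨ cong (_+ 2) n≡2q ⟩
  q * 2 + 2          ≡⟨ cong (_+ 2) (trans (*-comm q 2) (cong (q +_) (+-identityʳ q))) ⟩
  q + q + 2          ≡⟨ cong (λ h → h + h + 2) (trans (cong (_/ 2) n≡2q) (m*n/n≡m q 2)) ⟨
  n / 2 + n / 2 + 2  ∎
  where
  open ≡-Reasoning
  n≡2q : n ≡ q * 2
  n≡2q = suc-injective (suc-injective eq)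

union-closed : ∀ {n} {P : Fin n → Point} {A} → IsUnionOfComponents P A →
               ∀ {i j} → Adjacent P i j → i ∈ A → j ∈ A
union-closed (B , A⇔) {i} {j} adj i∈A =
  let (b , b∈B , path) = to (A⇔ i) i∈A in from (A⇔ j) (b , b∈B , path ◅◅ adj ◅ ε)

∣∩∣≡0 : ∀ {n} (A S : Subset n) → ∣ S ∣ ≡ 0 → ∣ A ∩ S ∣ ≡ 0
∣∩∣≡0 A S eq = n≤0⇒n≡0 (subst (∣ A ∩ S ∣ ≤_) eq (p⊆q⇒∣p∣≤∣q∣ (p∩q⊆q A S)))

-- With S and T given, the goal is an equation of natural numbers. It is ¬¬-stable, so a rational
-- approximation with the right orientations may be assumed.
halves-component : (n : ℕ) (P : Fin n → Point) → GeneralPosition P → 2 ∣ n →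
  (A : Subset n) → IsUnionOfComponents P A →
  (a b : Fin n) → a ≢ b →
  (S T : Subset n) → ∣ S ∣ ≡ (n ℕ.∸ 2) / 2 → ∣ T ∣ ≡ (n ℕ.∸ 2) / 2 →
  (∀ i → i ∈ S ⇔ LeftOf (P a) (P b) (P i)) → (∀ i → i ∈ T ⇔ RightOf (P a) (P b) (P i)) →
  ∣ A ∩ S ∣ ≡ ∣ A ∩ T ∣
-- For n at most 2 both sides are empty, as (n ∸ 2) / 2 is 0; `third-point` applies from three
-- points on.
halves-component 1 P gp _ A _ a b _ S T ∣S∣ ∣T∣ _ _ = trans (∣∩∣≡0 A S ∣S∣) (sym (∣∩∣≡0 A T ∣T∣))
halves-component 2 P gp _ A _ a b _ S T ∣S∣ ∣T∣ _ _ = trans (∣∩∣≡0 A S ∣S∣) (sym (∣∩∣≡0 A T ∣T∣))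
halves-component n@(suc (suc (suc n′))) P gp 2∣n A A-union a b a≢b S T ∣S∣ ∣T∣ S⇔ T⇔ =
  decidable-stable (∣ A ∩ S ∣ ≟ ∣ A ∩ T ∣) (¬¬-map (λ (m , agree) → atApproximation agree) (¬¬-agree P gp))
  where
  h : ℕ
  h = (n ℕ.∸ 2) / 2

  n≡ : n ≡ h + h + 2
  n≡ = even-half (suc n′) 2∣n

  atApproximation : ∀ {m} → Agree P gp m → ∣ A ∩ S ∣ ≡ ∣ A ∩ T ∣
  atApproximation agree = begin
    ∣ A ∩ S ∣
      ≡⟨ count S left? S⇔left ⟩
    ∑ (allFin n) (λ i → 𝟙 (i ∈? A) * 𝟙 (left? i))
      ≡⟨ halved x y noThreeCollinear n≡ third-point (λ i → 𝟙 (i ∈? A))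
           -- The weight is the indicator of A. A is closed under adjacency, and the edge read in
           -- both directions gives equal weights at its ends.
           (λ {i} {j} i≢j e → 𝟙-cong (i ∈? A) (j ∈? A)
             (union-closed {P = P} A-union (adjacent i≢j e))
             (union-closed {P = P} A-union (adjacent (i≢j ∘ sym) (leftCount-sym n≡ i≢j e))))
           a≢b (trans (sym (∣∣-count S left? S⇔left)) ∣S∣) ⟩
    ∑ (allFin n) (λ i → 𝟙 (i ∈? A) * 𝟙 (right? i))
      ≡⟨ count T right? T⇔right ⟨
    ∣ A ∩ T ∣ ∎
    where
    open ≡-Reasoning
    open Approximation P gp agree
    open Rotation x y noThreeCollinear using (leftCount-sym)

    left? : ∀ i → Dec (0ℚ ℚ.< det x y a b i)
    left? i = 0ℚ ℚ.<? det x y a b i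

    right? : ∀ i → Dec (0ℚ ℚ.< det x y b a i)
    right? i = 0ℚ ℚ.<? det x y b a i

    S⇔left : ∀ i → i ∈ S ⇔ 0ℚ ℚ.< det x y a b i
    S⇔left i = ⇔-sym (left⇔ a b i) ⇔-∘ S⇔ i

    T⇔right : ∀ i → i ∈ T ⇔ 0ℚ ℚ.< det x y b a i
    T⇔right i = ⇔-sym (right⇔ a b i) ⇔-∘ T⇔ i

    -- The sides are decidable at the approximation, which provides the subsets that a halving line
    -- of the real points requires.
    adjacent : ∀ {i j} → i ≢ j → leftCount x y i j ≡ h → Adjacent P i j
    adjacent {i} {j} i≢j e = i≢j
      , exactlyMany (λ k → 0ℚ ℚ.<? det x y i j k) (left⇔ i j) e
      , exactlyMany (λ k → 0ℚ ℚ.<? det x y j i k) (right⇔ i j) (leftCount-sym n≡ i≢j e)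

    count : ∀ (R : Subset n) {Q : Fin n → Set} (Q? : ∀ i → Dec (Q i)) → (∀ i → i ∈ R ⇔ Q i) →
            ∣ A ∩ R ∣ ≡ ∑ (allFin n) (λ i → 𝟙 (i ∈? A) * 𝟙 (Q? i))
    count R Q? R⇔ = trans
      (∣∣-count (A ∩ R) (λ i → (i ∈? A) ×-dec Q? i) (∩⇔ A R R⇔))
      (∑-cong (allFin n) λ i → 𝟙-× (i ∈? A) (Q? i))

mainTheorem2 : (n : ℕ) (P : Fin n → Point) → Injective _≡_ _≈ₚ_ P → GeneralPosition P → 2 ∣ n →
    (A : Subset n) → IsUnionOfComponents P A →
    (a b : Fin n) → a ∈ A → b ∈ A → IsHalvingLine P a b →
    ∃[ k ] (ExactlyMany k (λ i → i ∈ A × LeftOf (P a) (P b) (P i))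
    × ExactlyMany k (λ i → i ∈ A × RightOf (P a) (P b) (P i)))
mainTheorem2 n P _ gp 2∣n A A-union a b _ _ (a≢b , (S , ∣S∣ , S⇔) , (T , ∣T∣ , T⇔)) =
  ∣ A ∩ S ∣ , (A ∩ S , refl , ∩⇔ A S S⇔)
            , (A ∩ T , sym (halves-component n P gp 2∣n A A-union a b a≢b S T ∣S∣ ∣T∣ S⇔ T⇔) , ∩⇔ A T T⇔)
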